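{- For every integer $s\ge 3$, $m(3,s)\le \frac{73}{6}s^3+50$. Moreover, for every integer $s\ge 21$, $m(3,s)\le\frac{73}{6}s^3$.
   Context: $[n]=\{1,\dots,n\}$ and $\binom{[n]}{k}$ is the family of all $k$-element subsets of $[n]$; a family $\mathcal{F}\subset\binom{[n]}{k}$ is called a $k$-graph. The matching number $\nu(\mathcal{F})$ is the maximum number of pairwise disjoint members of $\mathcal{F}$. For $T\subset[n]$, $\mathcal{F}(\overline{T})=\{F\in\mathcal{F}: F\cap T=\emptyset\}$. A $k$-graph $\mathcal{F}\subset\binom{[n]}{k}$ is $t$-resilient if $\nu(\mathcal{F}(\overline{T}))=\nu(\mathcal{F})$ for every $T\subset[n]$ with $|T|\le t$. For positive integers $k,s$, $m(k,s)$ denotes the maximum of $|\mathcal{F}|$ over all $(k-1)$-resilient $k$-graphs $\mathcal{F}$ (on $[n]$, for any $n$) with $\nu(\mathcal{F})=s$. -}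

module Defs where

open import Data.Nat using (ℕ; _∸_; _≤_)
import Data.Integer as ℤ
import Data.Integer.Properties as ℤₚ
open import Data.Rational as ℚ using (ℚ)
import Data.Rational.Properties as ℚₚ
import Data.Rational.Unnormalised as ℚᵘ
import Data.Rational.Unnormalised.Properties as ℚᵘₚ
open import Data.Fin.Subset using (Subset; Empty; _∩_; ∣_∣)
open import Data.Fin.Subset.Properties using (nonempty?)
open import Data.List using (List; []; _∷_; _++_; map; filter; length)
open import Data.List.Extrema.Nat using (max; argmax-sel; xs≤max)
open import Data.List.Membership.Propositional using (_∈_)
open import Data.List.Membership.Propositional.Properties
  using (∈-++⁺ˡ; ∈-++⁺ʳ; ∈-++⁻; ∈-map⁺; ∈-map⁻; ∈-filter⁺; ∈-filter⁻)
open import Data.List.Relation.Unary.All as All using (All)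
import Data.List.Relation.Unary.All.Properties as Allₚ
open import Data.List.Relation.Unary.AllPairs using (AllPairs; []; allPairs?)
open import Data.List.Relation.Unary.Any using (here)
open import Data.List.Relation.Unary.Unique.Propositional using (Unique)
import Data.List.Relation.Unary.Unique.Propositional.Properties as Uniqueₚ
open import Data.List.Relation.Binary.Sublist.Propositional
  using (_⊆_; []; _∷_; _∷ʳ_; minimum)
open import Data.Product using (_×_; _,_; ∃-syntax)
open import Data.Sum using (inj₁; inj₂)
open import Function using (id)
open import Function.Bundles using (_⇔_; mk⇔)
open import Relation.Binary.PropositionalEquality using (_≡_; refl; sym)
open import Relation.Nullary using (Dec; ¬?)

private
  variable
    A : Set
    k n s : ℕ

-- The ground set [n] is Fin n.
record KGraph (k n : ℕ) : Set where
  field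
    edges   : List (Subset n)
    unique  : Unique edges
    uniform : All (λ E → ∣ E ∣ ≡ k) edges

open KGraph public

size : KGraph k n → ℕ
size F = length (edges F)

Disjoint : Subset n → Subset n → Set
Disjoint p q = Empty (p ∩ q)

disjoint? : (p q : Subset n) → Dec (Disjoint p q)
disjoint? p q = ¬? (nonempty? (p ∩ q))

-- F(T̄), the edges of F avoiding T.
_avoiding_ : KGraph k n → Subset n → KGraph k n
F avoiding T = record
  { edges   = filter (λ E → disjoint? E T) (edges F)
  ; unique  = Uniqueₚ.filter⁺ _ (unique F)
  ; uniform = Allₚ.filter⁺ _ (uniform F)
  }

sublists : List A → List (List A)
sublists []       = [] ∷ []
sublists (x ∷ xs) = map (x ∷_) (sublists xs) ++ sublists xs

-- Edges are listed without repetition, so the sublists of `edges F` are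
-- exactly the subfamilies of F.
matchings : KGraph k n → List (List (Subset n))
matchings F = filter (allPairs? disjoint?) (sublists (edges F))

-- The default value 0 is harmless: the empty family is always a matching.
ν : KGraph k n → ℕ
ν F = max 0 (map length (matchings F))

Resilient : ℕ → KGraph k n → Set
Resilient {n = n} t F = (T : Subset n) → ∣ T ∣ ≤ t → ν (F avoiding T) ≡ ν F

-- The set of sizes over which m(k,s) is the maximum (for positive k and s).
_∈Sizes[_,_] : ℕ → ℕ → ℕ → Set
N ∈Sizes[ k , s ] =
  ∃[ n ] ∃[ F ] (Resilient {k} {n} (k ∸ 1) F × ν F ≡ s × size F ≡ N)

fromℕ : ℕ → ℚ
fromℕ n = ℤ.+ n ℚ./ 1

infix 4 m[_,_]≤_

-- m(k,s) ≤ b.  A bound on a maximum is a bound on every element; see m≤⇔.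
m[_,_]≤_ : ℕ → ℕ → ℚ → Set
m[ k , s ]≤ b = ∀ N → N ∈Sizes[ k , s ] → fromℕ N ℚ.≤ b

-- M = m(k,s).
_Is-m[_,_] : ℕ → ℕ → ℕ → Set
M Is-m[ k , s ] = M ∈Sizes[ k , s ] × (∀ N → N ∈Sizes[ k , s ] → N ≤ M)

fromℕ-mono-≤ : ∀ {i j} → i ≤ j → fromℕ i ℚ.≤ fromℕ j
fromℕ-mono-≤ {i} {j} i≤j = ℚₚ.toℚᵘ-cancel-≤
  (ℚᵘₚ.≤-respˡ-≃ (ℚᵘₚ.≃-sym (ℚₚ.toℚᵘ-fromℚᵘ (ℤ.+ i ℚᵘ./ 1)))
  (ℚᵘₚ.≤-respʳ-≃ (ℚᵘₚ.≃-sym (ℚₚ.toℚᵘ-fromℚᵘ (ℤ.+ j ℚᵘ./ 1)))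
  (ℚᵘ.*≤* (ℤₚ.*-monoʳ-≤-nonNeg (ℤ.+ 1) (ℤ.+≤+ i≤j)))))

m≤⇔ : ∀ {M b} → M Is-m[ k , s ] → m[ k , s ]≤ b ⇔ fromℕ M ℚ.≤ b
m≤⇔ (M∈ , ub) = mk⇔
  (λ m≤b → m≤b _ M∈)
  (λ M≤b N N∈ → ℚₚ.≤-trans (fromℕ-mono-≤ (ub N N∈)) M≤b)

∈-sublists⁺ : {xs ys : List A} → xs ⊆ ys → xs ∈ sublists ys
∈-sublists⁺ []         = here refl
∈-sublists⁺ (y ∷ʳ p)   = ∈-++⁺ʳ _ (∈-sublists⁺ p)
∈-sublists⁺ (refl ∷ p) = ∈-++⁺ˡ (∈-map⁺ _ (∈-sublists⁺ p))

∈-sublists⁻ : ∀ {xs} (ys : List A) → xs ∈ sublists ys → xs ⊆ ys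
∈-sublists⁻ []       (here refl) = []
∈-sublists⁻ (y ∷ ys) xs∈ with ∈-++⁻ (map (y ∷_) (sublists ys)) xs∈
... | inj₂ q = y ∷ʳ ∈-sublists⁻ ys q
... | inj₁ q with _ , zs∈ , refl ← ∈-map⁻ (y ∷_) q = refl ∷ ∈-sublists⁻ ys zs∈

ν-upper : (F : KGraph k n) → ∀ {M} → M ⊆ edges F → AllPairs Disjoint M → length M ≤ ν F
ν-upper F M⊆ disj = All.lookup (xs≤max 0 (map length (matchings F)))
  (∈-map⁺ length (∈-filter⁺ (allPairs? disjoint?) (∈-sublists⁺ M⊆) disj))

ν-attained : (F : KGraph k n) →
  ∃[ M ] (M ⊆ edges F × AllPairs Disjoint M × length M ≡ ν F)
ν-attained F with argmax-sel id 0 (map length (matchings F))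
... | inj₁ ν≡0 = [] , minimum _ , [] , sym ν≡0
... | inj₂ ν∈ with M , M∈ , eq ← ∈-map⁻ length ν∈
  with M∈s , disj ← ∈-filter⁻ (allPairs? disjoint?) {xs = sublists (edges F)} M∈
  = M , ∈-sublists⁻ _ M∈s , disj , sym eq

{-# OPTIONS --safe #-}

-- Fix a maximum matching E₁, …, Eₛ and let O be the set of vertices outside it. Since the graph is
-- 2-resilient, every two vertices have codegree at most 3s and every vertex has degree at most 9s²:
-- the edges through T, |T| ≤ 2, are covered by any maximum matching avoiding T. Call a vertex of Eᵢ
-- big if its link has more than 3s edges in O. The remaining estimates come from exchanging one, two
-- or three of the Eᵢ for one more disjoint edge:
--   * if Eᵢ has no big vertex, at most 9s + 7 edges meet the matching only in Eᵢ; otherwise at most 8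
--     such edges avoid a chosen big vertex, and the edges through that vertex number at most 9s²;
--   * for the cells {x , y} with x ∈ Eᵢ, y ∈ Eⱼ, no three disjoint cells extend to disjoint edges by
--     vertices of O, so that at most 18s edges meet Eᵢ and Eⱼ in a cell and otherwise O (at most 9s or
--     16 once one or both chosen big vertices are deleted);
--   * at most 18 of the 27 triples in Eᵢ × Eⱼ × E_k are edges, up to what is lost in the 18s of the
--     three pairs: a triple disjoint from three large cells which partition the rest cannot be an edge.
--     This is a finite check on three subgraphs of K₃,₃ without perfect matching.
-- Summing up, there are at most 12s³ + s² + 4s edges, which for s ≥ 3 is at most 73s³/6 + 50, and
-- for s ≥ 9 at most 73s³/6.
module Submission where

-- The 9s³ in 12s³ = 9s³ + 3s³ comes from an amortisation. An edge of the matching with a big vertex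
-- is charged 9s² for the edges through that vertex, but its other two vertices are cheap in every
-- pair. An edge without a big vertex has no such charge, but costs 9s in each of the s - 1 pairs
-- containing it. Both kinds thus cost about 9s², and the number of big vertices drops out of the
-- sum. The triples of blocks give 18 · C(s,3), about 3s³. The obstacle is that 18 of 27 needs six
-- large cells in each of the three pairs. It lies in s - 2 triples, and in each of them up to 3d
-- further edges must be allowed. As 3(s - 2) exceeds 3s - 8 by only 2, the saving pays for these up
-- to a lower order term. The threshold 3s for a big vertex is the codegree bound: above it, some
-- edge of the link in O survives the deletion of any one vertex.

-- Sums over entries, pairs and triples of a list.

module Sums where
  open import Data.Nat using (ℕ; suc; _+_; _*_; _≤_; _<_; z≤n)
  open import Data.Nat.Properties
  open import Data.Nat.Tactic.RingSolver using (solve-∀)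
  open import Data.List
    using (List; []; _∷_; _++_; map; concatMap; length; filter; cartesianProduct)
  open import Data.List.Membership.Propositional using (_∈_; _∉_)
  open import Data.List.Membership.Propositional.Properties
    using (∈-∃++; ∈-++⁺ˡ; ∈-++⁺ʳ; ∈-++⁻; ∈-filter⁻; ∈-map⁺)
  import Data.List.Membership.DecPropositional as DecMembership
  open import Data.List.Properties using (++-assoc)
  open import Data.List.Relation.Unary.All as All using (All; []; _∷_)
  open import Data.List.Relation.Unary.Any using (here; there)
  open import Data.List.Relation.Unary.AllPairs using ([]; _∷_)
  open import Data.List.Relation.Unary.Unique.Propositional using (Unique)
  open import Data.List.Relation.Unary.Unique.Propositional.Properties using (filter⁺)
  open import Data.Product using (_×_; _,_; proj₂)
  open import Data.Sum using (_⊎_; inj₁; inj₂)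
  open import Function using (_∘_)
  open import Relation.Binary.Definitions using (DecidableEquality)
  open import Relation.Binary.PropositionalEquality
  open import Relation.Nullary using (yes; no; contradiction)

  private
    variable
      A B I : Set

  ∑ : List A → (A → ℕ) → ℕ
  ∑ []       f = 0
  ∑ (x ∷ xs) f = f x + ∑ xs f

  -- Sums over the positions i < j, respectively i < j < k, of a list.
  ∑₂ : List A → (A → A → ℕ) → ℕ
  ∑₂ []       f = 0
  ∑₂ (x ∷ xs) f = ∑ xs (f x) + ∑₂ xs f

  ∑₃ : List A → (A → A → A → ℕ) → ℕ
  ∑₃ []       f = 0
  ∑₃ (x ∷ xs) f = ∑₂ xs (f x) + ∑₃ xs f

  ∑-mono-∈ : (xs : List A) {f g : A → ℕ} → (∀ {x} → x ∈ xs → f x ≤ g x) → ∑ xs f ≤ ∑ xs g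
  ∑-mono-∈ []       f≤g = z≤n
  ∑-mono-∈ (x ∷ xs) f≤g = +-mono-≤ (f≤g (here refl)) (∑-mono-∈ xs (f≤g ∘ there))

  ∑-mono : (xs : List A) {f g : A → ℕ} → (∀ x → f x ≤ g x) → ∑ xs f ≤ ∑ xs g
  ∑-mono xs f≤g = ∑-mono-∈ xs (λ {x} _ → f≤g x)

  ∑₂-mono-∈ : (xs : List A) {f g : A → A → ℕ} →
    (∀ {x y} → x ∈ xs → y ∈ xs → f x y ≤ g x y) → ∑₂ xs f ≤ ∑₂ xs g
  ∑₂-mono-∈ []       f≤g = z≤n
  ∑₂-mono-∈ (x ∷ xs) f≤g = +-mono-≤ (∑-mono-∈ xs (f≤g (here refl) ∘ there))
    (∑₂-mono-∈ xs (λ p q → f≤g (there p) (there q)))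

  ∑₂-mono : (xs : List A) {f g : A → A → ℕ} → (∀ x y → f x y ≤ g x y) → ∑₂ xs f ≤ ∑₂ xs g
  ∑₂-mono xs f≤g = ∑₂-mono-∈ xs (λ {x} {y} _ _ → f≤g x y)

  ∑-cong : (xs : List A) {f g : A → ℕ} → (∀ x → f x ≡ g x) → ∑ xs f ≡ ∑ xs g
  ∑-cong []       f≡g = refl
  ∑-cong (x ∷ xs) f≡g = cong₂ _+_ (f≡g x) (∑-cong xs f≡g)

  ∑₂-cong : (xs : List A) {f g : A → A → ℕ} → (∀ x y → f x y ≡ g x y) → ∑₂ xs f ≡ ∑₂ xs g
  ∑₂-cong []       f≡g = refl
  ∑₂-cong (x ∷ xs) f≡g = cong₂ _+_ (∑-cong xs (f≡g x)) (∑₂-cong xs f≡g)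

  ∑-+ : (xs : List A) (f g : A → ℕ) → ∑ xs (λ x → f x + g x) ≡ ∑ xs f + ∑ xs g
  ∑-+ []       f g = refl
  ∑-+ (x ∷ xs) f g rewrite ∑-+ xs f g = interchange (f x) (g x) (∑ xs f) (∑ xs g)
    where
    interchange : ∀ a b c d → a + b + (c + d) ≡ a + c + (b + d)
    interchange = solve-∀

  ∑₂-+ : (xs : List A) (f g : A → A → ℕ) →
    ∑₂ xs (λ x y → f x y + g x y) ≡ ∑₂ xs f + ∑₂ xs g
  ∑₂-+ []       f g = refl
  ∑₂-+ (x ∷ xs) f g rewrite ∑-+ xs (f x) (g x) | ∑₂-+ xs f g =
    interchange (∑ xs (f x)) (∑ xs (g x)) (∑₂ xs f) (∑₂ xs g)
    where
    interchange : ∀ a b c d → a + b + (c + d) ≡ a + c + (b + d)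
    interchange = solve-∀

  ∑₃-+ : (xs : List A) (f g : A → A → A → ℕ) →
    ∑₃ xs (λ x y z → f x y z + g x y z) ≡ ∑₃ xs f + ∑₃ xs g
  ∑₃-+ []       f g = refl
  ∑₃-+ (x ∷ xs) f g rewrite ∑₂-+ xs (f x) (g x) | ∑₃-+ xs f g =
    interchange (∑₂ xs (f x)) (∑₂ xs (g x)) (∑₃ xs f) (∑₃ xs g)
    where
    interchange : ∀ a b c d → a + b + (c + d) ≡ a + c + (b + d)
    interchange = solve-∀

  ∑-*ˡ : (xs : List A) (c : ℕ) (f : A → ℕ) → ∑ xs (λ x → c * f x) ≡ c * ∑ xs f
  ∑-*ˡ []       c f = sym (*-zeroʳ c)
  ∑-*ˡ (x ∷ xs) c f rewrite ∑-*ˡ xs c f = sym (*-distribˡ-+ c (f x) (∑ xs f))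

  ∑₂-*ˡ : (xs : List A) (c : ℕ) (f : A → A → ℕ) → ∑₂ xs (λ x y → c * f x y) ≡ c * ∑₂ xs f
  ∑₂-*ˡ []       c f = sym (*-zeroʳ c)
  ∑₂-*ˡ (x ∷ xs) c f rewrite ∑-*ˡ xs c (f x) | ∑₂-*ˡ xs c f =
    sym (*-distribˡ-+ c (∑ xs (f x)) (∑₂ xs f))

  ∑₃-*ˡ : (xs : List A) (c : ℕ) (f : A → A → A → ℕ) → ∑₃ xs (λ x y z → c * f x y z) ≡ c * ∑₃ xs f
  ∑₃-*ˡ []       c f = sym (*-zeroʳ c)
  ∑₃-*ˡ (x ∷ xs) c f rewrite ∑₂-*ˡ xs c (f x) | ∑₃-*ˡ xs c f =
    sym (*-distribˡ-+ c (∑₂ xs (f x)) (∑₃ xs f))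

  ∑-const : (xs : List A) (c : ℕ) → ∑ xs (λ _ → c) ≡ length xs * c
  ∑-const []       c = refl
  ∑-const (x ∷ xs) c = cong (c +_) (∑-const xs c)

  ∑-zero : (xs : List A) {f : A → ℕ} → (∀ {x} → x ∈ xs → f x ≡ 0) → ∑ xs f ≡ 0
  ∑-zero []       f≡0 = refl
  ∑-zero (x ∷ xs) f≡0 = cong₂ _+_ (f≡0 (here refl)) (∑-zero xs (f≡0 ∘ there))

  ∑-++ : (xs ys : List A) (f : A → ℕ) → ∑ (xs ++ ys) f ≡ ∑ xs f + ∑ ys f
  ∑-++ []       ys f = refl
  ∑-++ (x ∷ xs) ys f rewrite ∑-++ xs ys f = sym (+-assoc (f x) (∑ xs f) (∑ ys f))

  ∑₂-++ : (xs ys : List A) (f : A → A → ℕ) →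
    ∑₂ (xs ++ ys) f ≡ ∑₂ xs f + ∑ xs (λ x → ∑ ys (f x)) + ∑₂ ys f
  ∑₂-++ []       ys f = refl
  ∑₂-++ (x ∷ xs) ys f rewrite ∑-++ xs ys (f x) | ∑₂-++ xs ys f =
    regroup (∑ xs (f x)) (∑ ys (f x)) (∑₂ xs f) (∑ xs (λ x → ∑ ys (f x))) (∑₂ ys f)
    where
    regroup : ∀ a b c d e → a + b + (c + d + e) ≡ a + c + (b + d) + e
    regroup = solve-∀

  ∑₃-++ : (xs ys : List A) (f : A → A → A → ℕ) →
    ∑₃ (xs ++ ys) f
      ≡ ∑₃ xs f + ∑₂ xs (λ x y → ∑ ys (f x y)) + ∑ xs (λ x → ∑₂ ys (f x)) + ∑₃ ys f
  ∑₃-++ []       ys f = refl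
  ∑₃-++ (x ∷ xs) ys f rewrite ∑₂-++ xs ys (f x) | ∑₃-++ xs ys f =
    regroup (∑₂ xs (f x)) (∑ xs (λ y → ∑ ys (f x y))) (∑₂ ys (f x)) (∑₃ xs f)
      (∑₂ xs (λ x y → ∑ ys (f x y))) (∑ xs (λ x → ∑₂ ys (f x))) (∑₃ ys f)
    where
    regroup : ∀ a b c d e g h → a + b + c + (d + e + g + h) ≡ a + d + (b + e) + (c + g) + h
    regroup = solve-∀

  ∑-comm : (xs : List A) (ys : List B) (f : A → B → ℕ) →
    ∑ xs (λ x → ∑ ys (f x)) ≡ ∑ ys (λ y → ∑ xs (λ x → f x y))
  ∑-comm []       ys f = sym (trans (∑-const ys 0) (*-zeroʳ (length ys)))
  ∑-comm (x ∷ xs) ys f rewrite ∑-comm xs ys f = sym (∑-+ ys (f x) (λ y → ∑ xs (λ x → f x y)))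

  ∑₂-∑-comm : (xs : List A) (ys : List B) (f : A → A → B → ℕ) →
    ∑₂ xs (λ x x′ → ∑ ys (f x x′)) ≡ ∑ ys (λ y → ∑₂ xs (λ x x′ → f x x′ y))
  ∑₂-∑-comm []       ys f = sym (trans (∑-const ys 0) (*-zeroʳ (length ys)))
  ∑₂-∑-comm (x ∷ xs) ys f rewrite ∑-comm xs ys (f x) | ∑₂-∑-comm xs ys f =
    sym (∑-+ ys (λ y → ∑ xs (λ x′ → f x x′ y)) (λ y → ∑₂ xs (λ x x′ → f x x′ y)))

  ∑-∑₂-comm : (xs : List A) (ys : List B) (f : A → B → B → ℕ) →
    ∑ xs (λ x → ∑₂ ys (f x)) ≡ ∑₂ ys (λ y y′ → ∑ xs (λ x → f x y y′))
  ∑-∑₂-comm xs ys f = sym (∑₂-∑-comm ys xs (λ y y′ x → f x y y′))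

  ∑-concatMap : (B : I → List A) (is : List I) (f : A → ℕ) →
    ∑ (concatMap B is) f ≡ ∑ is (λ i → ∑ (B i) f)
  ∑-concatMap B []       f = refl
  ∑-concatMap B (i ∷ is) f = trans (∑-++ (B i) (concatMap B is) f)
    (cong (∑ (B i) f +_) (∑-concatMap B is f))

  ∑-map : (g : A → B) (xs : List A) (f : B → ℕ) → ∑ (map g xs) f ≡ ∑ xs (λ x → f (g x))
  ∑-map g []       f = refl
  ∑-map g (x ∷ xs) f = cong (f (g x) +_) (∑-map g xs f)

  ∑-cartesianProduct : (xs : List A) (ys : List B) (f : A × B → ℕ) →
    ∑ (cartesianProduct xs ys) f ≡ ∑ xs (λ x → ∑ ys (λ y → f (x , y)))
  ∑-cartesianProduct []       ys f = refl
  ∑-cartesianProduct (x ∷ xs) ys f = trans (∑-++ (map (x ,_) ys) (cartesianProduct xs ys) f)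
    (cong₂ _+_ (∑-map (x ,_) ys f) (∑-cartesianProduct xs ys f))

  -- Double counting: each entry lies in `length xs` - 1 pairs. The extra sum on the left avoids a
  -- subtraction.
  ∑₂-pairs : (h : A → ℕ) (xs : List A) →
    ∑₂ xs (λ x y → h x + h y) + ∑ xs h ≡ length xs * ∑ xs h
  ∑₂-pairs h []       = refl
  ∑₂-pairs h (x ∷ xs) rewrite ∑-+ xs (λ _ → h x) h | ∑-const xs (h x) = begin
    n * h x + S + P + (h x + S)       ≡⟨ regroup n (h x) S P ⟩
    h x + S + (n * h x + (P + S))     ≡⟨ cong (λ t → h x + S + (n * h x + t)) (∑₂-pairs h xs) ⟩
    h x + S + (n * h x + n * S)       ≡⟨ cong (h x + S +_) (*-distribˡ-+ n (h x) S) ⟨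
    suc n * (h x + S)                 ∎
    where
    open ≡-Reasoning
    n = length xs
    S = ∑ xs h
    P = ∑₂ xs (λ x y → h x + h y)
    regroup : ∀ n h S P → n * h + S + P + (h + S) ≡ h + S + (n * h + (P + S))
    regroup = solve-∀

  -- Each pair lies in `length xs` - 2 triples. In the induction, the pairs containing `x` are
  -- handled by `∑₂-pairs` for the function `d x`.
  ∑₃-pairs : (d : A → A → ℕ) (xs : List A) →
    ∑₃ xs (λ x y z → d x y + d x z + d y z) + 2 * ∑₂ xs d ≡ length xs * ∑₂ xs d
  ∑₃-pairs d []       = refl
  ∑₃-pairs d (x ∷ xs) rewrite ∑₂-+ xs (λ y z → d x y + d x z) d = begin
    P + S + T + 2 * (D + S)                ≡⟨ regroup P S T D ⟩
    (P + D) + (T + 2 * S) + (D + S)        ≡⟨ cong₂ (λ a b → a + b + (D + S))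
                                                  (∑₂-pairs (d x) xs) (∑₃-pairs d xs) ⟩
    n * D + n * S + (D + S)                ≡⟨ regroup′ n D S ⟩
    suc n * (D + S)                        ∎
    where
    open ≡-Reasoning
    n = length xs
    D = ∑ xs (d x)
    S = ∑₂ xs d
    P = ∑₂ xs (λ y z → d x y + d x z)
    T = ∑₃ xs (λ x y z → d x y + d x z + d y z)
    regroup : ∀ P S T D → P + S + T + 2 * (D + S) ≡ (P + D) + (T + 2 * S) + (D + S)
    regroup = solve-∀
    regroup′ : ∀ n D S → n * D + n * S + (D + S) ≡ suc n * (D + S)
    regroup′ = solve-∀

  -- The blocks to be summed over carry a proof besides their index, so distinctness is asked of the
  -- images under `h`.
  ∑₂-mono-≢ : {h : A → B} (xs : List A) {f g : A → A → ℕ} → Unique (map h xs) →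
    (∀ {x y} → h x ≢ h y → f x y ≤ g x y) → ∑₂ xs f ≤ ∑₂ xs g
  ∑₂-mono-≢ []       u        f≤g = z≤n
  ∑₂-mono-≢ {h = h} (x ∷ xs) (x∉ ∷ u) f≤g = +-mono-≤
    (∑-mono-∈ xs (λ y∈ → f≤g (All.lookup x∉ (∈-map⁺ h y∈)))) (∑₂-mono-≢ xs u f≤g)

  ∑₃-mono-≢ : {h : A → B} (xs : List A) {f g : A → A → A → ℕ} → Unique (map h xs) →
    (∀ {x y z} → h x ≢ h y → h x ≢ h z → h y ≢ h z → f x y z ≤ g x y z) → ∑₃ xs f ≤ ∑₃ xs g
  ∑₃-mono-≢ []       u        f≤g = z≤n
  ∑₃-mono-≢ {h = h} (x ∷ xs) {f} {g} (x∉ ∷ u) f≤g = +-mono-≤ (pairs xs x∉ u) (∑₃-mono-≢ xs u f≤g)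
    where
    pairs : ∀ ys → All (h x ≢_) (map h ys) → Unique (map h ys) → ∑₂ ys (f x) ≤ ∑₂ ys (g x)
    pairs []       _          _        = z≤n
    pairs (y ∷ ys) (x≢y ∷ x≢) (y∉ ∷ u) = +-mono-≤
      (∑-mono-∈ ys (λ z∈ → f≤g x≢y (All.lookup x≢ (∈-map⁺ h z∈)) (All.lookup y∉ (∈-map⁺ h z∈))))
      (pairs ys x≢ u)

  -- The triples of (⋃ B i) ∪ O, sorted by the set of blocks B i they meet.
  module Blocks (B : I → List A) (O : List A) (f : A → A → A → ℕ) where

    single : I → ℕ
    single i = ∑₃ (B i) f + ∑₂ (B i) (λ a b → ∑ O (f a b)) + ∑ (B i) (λ a → ∑₂ O (f a))

    pair : I → I → ℕ
    pair i j = ∑₂ (B i) (λ a b → ∑ (B j) (f a b)) + ∑ (B i) (λ a → ∑₂ (B j) (f a))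
      + ∑ (B i) (λ a → ∑ (B j) (λ b → ∑ O (f a b)))

    triple : I → I → I → ℕ
    triple i j k = ∑ (B i) (λ a → ∑ (B j) (λ b → ∑ (B k) (f a b)))

    ∑-blocks : (is : List I) (g : A → ℕ) →
      ∑ (concatMap B is ++ O) g ≡ ∑ is (λ i → ∑ (B i) g) + ∑ O g
    ∑-blocks is g = trans (∑-++ (concatMap B is) O g) (cong (_+ ∑ O g) (∑-concatMap B is g))

    ∑₂-blocks : (is : List I) (g : A → A → ℕ) →
      ∑₂ (concatMap B is ++ O) g
        ≡ ∑ is (λ i → ∑₂ (B i) g + ∑ (B i) (λ a → ∑ O (g a)))
          + ∑₂ is (λ i j → ∑ (B i) (λ a → ∑ (B j) (g a))) + ∑₂ O g
    ∑₂-blocks []       g = refl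
    ∑₂-blocks (i ∷ is) g = begin
      ∑₂ ((B i ++ concatMap B is) ++ O) g
        ≡⟨ cong (λ l → ∑₂ l g) (++-assoc (B i) (concatMap B is) O) ⟩
      ∑₂ (B i ++ R) g
        ≡⟨ ∑₂-++ (B i) R g ⟩
      ∑₂ (B i) g + ∑ (B i) (λ a → ∑ R (g a)) + ∑₂ R g
        ≡⟨ cong₂ (λ x y → ∑₂ (B i) g + x + y) cross (∑₂-blocks is g) ⟩
      ∑₂ (B i) g + (P + O′) + (S + Q + ∑₂ O g)
        ≡⟨ regroup (∑₂ (B i) g) P O′ S Q (∑₂ O g) ⟩
      ∑₂ (B i) g + O′ + S + (P + Q) + ∑₂ O g ∎
      where
      open ≡-Reasoning
      R = concatMap B is ++ O
      P = ∑ is (λ j → ∑ (B i) (λ a → ∑ (B j) (g a)))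
      O′ = ∑ (B i) (λ a → ∑ O (g a))
      S = ∑ is (λ i → ∑₂ (B i) g + ∑ (B i) (λ a → ∑ O (g a)))
      Q = ∑₂ is (λ i j → ∑ (B i) (λ a → ∑ (B j) (g a)))
      cross : ∑ (B i) (λ a → ∑ R (g a)) ≡ P + O′
      cross = begin
        ∑ (B i) (λ a → ∑ R (g a))
          ≡⟨ ∑-cong (B i) (λ a → ∑-blocks is (g a)) ⟩
        ∑ (B i) (λ a → ∑ is (λ j → ∑ (B j) (g a)) + ∑ O (g a))
          ≡⟨ ∑-+ (B i) _ _ ⟩
        ∑ (B i) (λ a → ∑ is (λ j → ∑ (B j) (g a))) + O′
          ≡⟨ cong (_+ O′) (∑-comm (B i) is _) ⟩
        P + O′ ∎
      regroup : ∀ a b c d e f → a + (b + c) + (d + e + f) ≡ a + c + d + (b + e) + f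
      regroup = solve-∀

    -- Peel off one block: a triple has three, two, one or no entries in it. When two entries or one
    -- lie in it, the others are distributed over the remaining blocks and `O` by `∑-blocks` and
    -- `∑₂-blocks`.
    ∑₃-blocks : (is : List I) →
      ∑₃ (concatMap B is ++ O) f ≡ ∑ is single + ∑₂ is pair + ∑₃ is triple + ∑₃ O f
    ∑₃-blocks []       = refl
    ∑₃-blocks (i ∷ is) = begin
      ∑₃ ((B i ++ concatMap B is) ++ O) f
        ≡⟨ cong (λ l → ∑₃ l f) (++-assoc (B i) (concatMap B is) O) ⟩
      ∑₃ (B i ++ R) f
        ≡⟨ ∑₃-++ (B i) R f ⟩
      ∑₃ (B i) f + ∑₂ (B i) (λ a b → ∑ R (f a b)) + ∑ (B i) (λ a → ∑₂ R (f a)) + ∑₃ R f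
        ≡⟨ cong₂ (λ x y → ∑₃ (B i) f + x + y + ∑₃ R f) cross₂ cross₁ ⟩
      ∑₃ (B i) f + (P₁ + N) + (P₂ + P₃ + T + G) + ∑₃ R f
        ≡⟨ cong (∑₃ (B i) f + (P₁ + N) + (P₂ + P₃ + T + G) +_) (∑₃-blocks is) ⟩
      ∑₃ (B i) f + (P₁ + N) + (P₂ + P₃ + T + G)
        + (∑ is single + ∑₂ is pair + ∑₃ is triple + ∑₃ O f)
        ≡⟨ regroup (∑₃ (B i) f) P₁ N P₂ P₃ T G
             (∑ is single) (∑₂ is pair) (∑₃ is triple) (∑₃ O f) ⟩
      single i + ∑ is single + (P₁ + P₂ + P₃ + ∑₂ is pair) + (T + ∑₃ is triple) + ∑₃ O f
        ≡⟨ cong (λ x → single i + ∑ is single + (x + ∑₂ is pair) + (T + ∑₃ is triple) + ∑₃ O f)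
             (sym (trans (∑-+ is _ _) (cong (_+ P₃) (∑-+ is _ _)))) ⟩
      single i + ∑ is single + (∑ is (pair i) + ∑₂ is pair) + (T + ∑₃ is triple) + ∑₃ O f ∎
      where
      open ≡-Reasoning
      R = concatMap B is ++ O
      N = ∑₂ (B i) (λ a b → ∑ O (f a b))
      G = ∑ (B i) (λ a → ∑₂ O (f a))
      P₁ = ∑ is (λ j → ∑₂ (B i) (λ a b → ∑ (B j) (f a b)))
      P₂ = ∑ is (λ j → ∑ (B i) (λ a → ∑₂ (B j) (f a)))
      P₃ = ∑ is (λ j → ∑ (B i) (λ a → ∑ (B j) (λ b → ∑ O (f a b))))
      T = ∑₂ is (triple i)
      cross₂ : ∑₂ (B i) (λ a b → ∑ R (f a b)) ≡ P₁ + N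
      cross₂ = begin
        ∑₂ (B i) (λ a b → ∑ R (f a b))
          ≡⟨ ∑₂-cong (B i) (λ a b → ∑-blocks is (f a b)) ⟩
        ∑₂ (B i) (λ a b → ∑ is (λ j → ∑ (B j) (f a b)) + ∑ O (f a b))
          ≡⟨ ∑₂-+ (B i) _ _ ⟩
        ∑₂ (B i) (λ a b → ∑ is (λ j → ∑ (B j) (f a b))) + N
          ≡⟨ cong (_+ N) (∑₂-∑-comm (B i) is _) ⟩
        P₁ + N ∎
      cross₁ : ∑ (B i) (λ a → ∑₂ R (f a)) ≡ P₂ + P₃ + T + G
      cross₁ = begin
        ∑ (B i) (λ a → ∑₂ R (f a))
          ≡⟨ ∑-cong (B i) (λ a → ∑₂-blocks is (f a)) ⟩
        ∑ (B i) (λ a → ∑ is (λ j → ∑₂ (B j) (f a) + ∑ (B j) (λ b → ∑ O (f a b)))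
          + ∑₂ is (λ j k → ∑ (B j) (λ b → ∑ (B k) (f a b))) + ∑₂ O (f a))
          ≡⟨ trans (∑-+ (B i) _ _) (cong (_+ G) (∑-+ (B i) _ _)) ⟩
        ∑ (B i) (λ a → ∑ is (λ j → ∑₂ (B j) (f a) + ∑ (B j) (λ b → ∑ O (f a b))))
          + ∑ (B i) (λ a → ∑₂ is (λ j k → ∑ (B j) (λ b → ∑ (B k) (f a b)))) + G
          ≡⟨ cong₂ (λ x y → x + y + G) (∑-comm (B i) is _) (∑-∑₂-comm (B i) is _) ⟩
        ∑ is (λ j → ∑ (B i) (λ a → ∑₂ (B j) (f a) + ∑ (B j) (λ b → ∑ O (f a b)))) + T + G
          ≡⟨ cong (λ x → x + T + G) (trans (∑-cong is (λ j → ∑-+ (B i) _ _)) (∑-+ is _ _)) ⟩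
        P₂ + P₃ + T + G ∎
      regroup : ∀ a b c d e g h k l m o →
        a + (b + c) + (d + e + g + h) + (k + l + m + o)
          ≡ a + c + h + k + (b + d + e + l) + (g + m) + o
      regroup = solve-∀

  -- Supports and vertex covers.

  -- Each entry of positive value is cancelled against one occurrence in `ys`; since `xs` has no
  -- repetitions, the later entries survive this removal.
  ∑-⊆ : {xs ys : List A} (f : A → ℕ) → Unique xs →
    (∀ {x} → x ∈ xs → 0 < f x → x ∈ ys) → ∑ xs f ≤ ∑ ys f
  ∑-⊆ {xs = []}          f _        _   = z≤n
  ∑-⊆ {xs = x ∷ xs} {ys} f (x∉ ∷ u) xs⊆ with 0 <? f x
  ... | no ¬p rewrite n≤0⇒n≡0 (≮⇒≥ ¬p) = ∑-⊆ f u (xs⊆ ∘ there)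
  ... | yes p with us , vs , refl ← ∈-∃++ (xs⊆ (here refl) p) = begin
    f x + ∑ xs f             ≤⟨ +-monoʳ-≤ (f x) (∑-⊆ f u rest) ⟩
    f x + ∑ (us ++ vs) f     ≡⟨ cong (f x +_) (∑-++ us vs f) ⟩
    f x + (∑ us f + ∑ vs f)  ≡⟨ swap (f x) (∑ us f) (∑ vs f) ⟩
    ∑ us f + (f x + ∑ vs f)  ≡⟨ ∑-++ us (x ∷ vs) f ⟨
    ∑ (us ++ x ∷ vs) f       ∎
    where
    open ≤-Reasoning
    swap : ∀ a b c → a + (b + c) ≡ b + (a + c)
    swap = solve-∀
    rest : ∀ {y} → y ∈ xs → 0 < f y → y ∈ us ++ vs
    rest y∈ 0<fy with ∈-++⁻ us (xs⊆ (there y∈) 0<fy)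
    ... | inj₁ q         = ∈-++⁺ˡ q
    ... | inj₂ (here eq) = contradiction (sym eq) (All.lookup x∉ y∈)
    ... | inj₂ (there q) = ∈-++⁺ʳ us q

  ∑-1 : (xs : List A) → ∑ xs (λ _ → 1) ≡ length xs
  ∑-1 xs = trans (∑-const xs 1) (*-identityʳ (length xs))

  ∑-support : {xs D : List A} {f : A → ℕ} → Unique xs → (∀ x → f x ≤ 1) →
    (∀ {x} → x ∈ xs → 0 < f x → x ∈ D) → ∑ xs f ≤ length D
  ∑-support {D = D} {f} u f≤1 supp =
    ≤-trans (∑-⊆ f u supp) (≤-trans (∑-mono D f≤1) (≤-reflexive (∑-1 D)))

  length-⊆ : {xs ys : List A} → Unique xs → (∀ {x} → x ∈ xs → x ∈ ys) → length xs ≤ length ys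
  length-⊆ {xs = xs} {ys} u xs⊆ = begin
    length xs         ≡⟨ ∑-1 xs ⟨
    ∑ xs (λ _ → 1)    ≤⟨ ∑-⊆ _ u (λ p _ → xs⊆ p) ⟩
    ∑ ys (λ _ → 1)    ≡⟨ ∑-1 ys ⟩
    length ys         ∎
    where open ≤-Reasoning

  module _ (_≟_ : DecidableEquality A) where
    open DecMembership _≟_ using (_∈?_)

    -- Each edge is charged to an endpoint in the cover. The induction charges only to entries of
    -- `xs` lying in `C`, because `C` may have repetitions and entries outside of `xs`; `∑-⊆` passes
    -- to `C` at the end.
    ∑₂-cover : {xs C : List A} {f : A → A → ℕ} → Unique xs → (∀ x y → f x y ≡ f y x) →
      (∀ {x y} → x ∈ xs → y ∈ xs → 0 < f x y → x ∈ C ⊎ y ∈ C) →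
      ∑₂ xs f ≤ ∑ C (λ c → ∑ xs (f c))
    ∑₂-cover {xs} {C} {f} u f-sym cov =
      ≤-trans (go xs (λ p → p))
        (∑-⊆ _ (filter⁺ (_∈? C) u) (λ x∈ _ → proj₂ (∈-filter⁻ (_∈? C) {xs = xs} x∈)))
      where
      covered : List A → ℕ
      covered ys = ∑ (filter (_∈? C) ys) (λ c → ∑ ys (f c))
      grow : ∀ y ys zs → ∑ zs (λ c → ∑ ys (f c)) ≤ ∑ zs (λ c → ∑ (y ∷ ys) (f c))
      grow y ys zs = ∑-mono zs (λ c → m≤n+m _ _)
      -- All edges at a vertex outside the cover are charged to their other endpoint.
      outside : ∀ {y} → y ∈ xs → y ∉ C → ∀ ys → (∀ {x} → x ∈ ys → x ∈ xs) →
        ∑ ys (f y) ≤ ∑ (filter (_∈? C) ys) (λ c → f c y)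
      outside         y∈ y∉C []       ys⊆ = z≤n
      outside {y = y} y∈ y∉C (z ∷ ys) ys⊆ with z ∈? C
      ... | yes _  = +-mono-≤ (≤-reflexive (f-sym y z)) (outside y∈ y∉C ys (λ p → ys⊆ (there p)))
      ... | no z∉C with 0 <? f y z
      ...   | no ¬p rewrite n≤0⇒n≡0 (≮⇒≥ ¬p) = outside y∈ y∉C ys (λ p → ys⊆ (there p))
      ...   | yes p with cov y∈ (ys⊆ (here refl)) p
      ...     | inj₁ y∈C = contradiction y∈C y∉C
      ...     | inj₂ z∈C = contradiction z∈C z∉C
      go : ∀ ys → (∀ {x} → x ∈ ys → x ∈ xs) → ∑₂ ys f ≤ covered ys
      go []       ys⊆ = z≤n
      go (y ∷ ys) ys⊆ with y ∈? C
      ... | yes _  = +-mono-≤ (m≤n+m _ _)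
        (≤-trans (go ys (λ p → ys⊆ (there p))) (grow y ys (filter (_∈? C) ys)))
      ... | no y∉C = ≤-trans
        (+-mono-≤ (outside (ys⊆ (here refl)) y∉C ys (λ p → ys⊆ (there p)))
          (go ys (λ p → ys⊆ (there p))))
        (≤-reflexive (sym (∑-+ (filter (_∈? C) ys) _ _)))

-- Subgraphs of K₃,₃ without perfect matching.

module BipartiteGraphs where
  open Sums
  open import Data.Bool using (Bool; true; false; T; T?; not; _∧_; _∨_; if_then_else_)
  open import Data.Bool.ListAction using (all; any)
  open import Data.Bool.Properties using (T-∧; T-∨; T-≡; T-not-≡; ¬-not)
  open import Data.Fin using (Fin)
  open import Data.Fin.Patterns using (0F; 1F; 2F)
  open import Data.Nat using (ℕ; zero; suc; _+_; _*_; _∸_; _≤_; _<_; z≤n; s≤s; _≤ᵇ_; _≤?_)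
  open import Data.Nat.Properties
  open import Data.Nat.Tactic.RingSolver using (solve-∀)
  open import Data.List
    using (List; []; _∷_; map; filterᵇ; cartesianProduct; cartesianProductWith)
  open import Data.List.Membership.Propositional using (_∈_; find)
  open import Data.List.Membership.Propositional.Properties
    using (∈-filter⁺; ∈-map⁺; ∈-cartesianProductWith⁺; ∈-allFin)
  open import Data.List.Relation.Unary.All as All using (All; []; _∷_)
  import Data.List.Relation.Unary.All.Properties as All
  open import Data.List.Relation.Unary.Any as Any using (Any; here; there)
  import Data.List.Relation.Unary.Any.Properties as Any
  open import Data.Product using (_×_; _,_; proj₁; proj₂; ∃-syntax)
  open import Data.Sum using (inj₁; inj₂)
  open import Data.Unit using (tt)
  open import Data.Vec using (Vec; []; _∷_; lookup; tabulate)
  open import Data.Vec.Properties using (lookup∘tabulate)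
  open import Function using (_∘_; Equivalence)
  open import Relation.Binary.PropositionalEquality
  open import Relation.Nullary using (yes; no; ¬_; contradiction)

  cols : List (Fin 3)
  cols = 0F ∷ 1F ∷ 2F ∷ []

  -- Both orders are listed because the two entries play different roles in `killed`: they are
  -- matched into different blocks.
  rest : Fin 3 → List (Fin 3 × Fin 3)
  rest 0F = (1F , 2F) ∷ (2F , 1F) ∷ []
  rest 1F = (0F , 2F) ∷ (2F , 0F) ∷ []
  rest 2F = (0F , 1F) ∷ (1F , 0F) ∷ []

  -- Subgraphs of K₃,₃, as adjacency matrices.
  Graph : Set
  Graph = Vec (Vec Bool 3) 3

  at : Graph → Fin 3 → Fin 3 → Bool
  at g a b = lookup (lookup g a) b

  graph : (Fin 3 → Fin 3 → Bool) → Graph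
  graph h = tabulate (λ a → tabulate (h a))

  at-graph : ∀ h a b → at (graph h) a b ≡ h a b
  at-graph h a b = trans (cong (λ r → lookup r b) (lookup∘tabulate (λ a → tabulate (h a)) a))
    (lookup∘tabulate (h a) b)

  vecs : {A : Set} → List A → (n : ℕ) → List (Vec A n)
  vecs xs zero    = [] ∷ []
  vecs xs (suc n) = cartesianProductWith _∷_ xs (vecs xs n)

  ∈-vecs : {A : Set} {xs : List A} → (∀ x → x ∈ xs) → ∀ {n} (v : Vec A n) → v ∈ vecs xs n
  ∈-vecs all∈ []      = here refl
  ∈-vecs all∈ (x ∷ v) = ∈-cartesianProductWith⁺ _∷_ (all∈ x) (∈-vecs all∈ v)

  graphs : List Graph
  graphs = vecs (vecs (true ∷ false ∷ []) 3) 3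

  ∈-graphs : ∀ g → g ∈ graphs
  ∈-graphs = ∈-vecs {xs = vecs (true ∷ false ∷ []) 3} (∈-vecs {xs = true ∷ false ∷ []}
    λ { true → here refl ; false → there (here refl) })

  𝟙 : Bool → ℕ
  𝟙 true  = 1
  𝟙 false = 0

  size₃₃ : Graph → ℕ
  size₃₃ g = ∑ cols λ a → ∑ cols λ b → 𝟙 (at g a b)

  -- Six is the maximal size without a perfect matching, see `size₃₃≤6`; for such graphs the
  -- subtraction is exact.
  deficit : Graph → ℕ
  deficit g = 6 ∸ size₃₃ g

  -- The edges of g avoiding row a and column b contain a matching of size two.
  completes : Graph → Fin 3 → Fin 3 → Bool
  completes g a b =
    any (λ (a₁ , a₂) → any (λ (b₁ , b₂) → at g a₁ b₁ ∧ at g a₂ b₂) (rest b)) (rest a)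

  hasPM : Graph → Bool
  hasPM g = any (λ b → at g 0F b ∧ completes g 0F b) cols

  -- The vertices other than a, b, c of three disjoint triples are matched by one edge from each
  -- of the bipartite graphs g₁₂, g₁₃, g₂₃ between the triples.
  killed : Graph → Graph → Graph → Fin 3 × Fin 3 × Fin 3 → Bool
  killed g₁₂ g₁₃ g₂₃ (a , b , c) =
    any (λ (a₁ , a₂) → any (λ (b₁ , b₂) → at g₁₂ a₁ b₁ ∧
      any (λ (c₁ , c₂) → at g₁₃ a₂ c₁ ∧ at g₂₃ b₂ c₂) (rest c)) (rest b)) (rest a)

  cells : List (Fin 3 × Fin 3 × Fin 3)
  cells = cartesianProduct cols (cartesianProduct cols cols)

  -- Stops at the last hit required, which shortens the evaluation of `checkKilled`.
  atLeast : {A : Set} → ℕ → (A → Bool) → List A → Bool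
  atLeast zero    p xs       = true
  atLeast (suc n) p []       = false
  atLeast (suc n) p (x ∷ xs) = if p x then atLeast n p xs else atLeast (suc n) p xs

  atLeast-∑ : {A : Set} (n : ℕ) (p : A → Bool) (xs : List A) →
    T (atLeast n p xs) → n ≤ ∑ xs (λ x → 𝟙 (p x))
  atLeast-∑ zero    p xs       _ = z≤n
  atLeast-∑ (suc n) p (x ∷ xs) h with p x
  ... | true  = s≤s (atLeast-∑ n p xs h)
  ... | false = atLeast-∑ (suc n) p xs h

  relevant : ℕ × Graph → Bool
  relevant (d , g) = not (hasPM g) ∧ (d ≤ᵇ 2)

  smallDeficit : List (ℕ × Graph)
  smallDeficit = filterᵇ relevant (map (λ g → deficit g , g) graphs)

  -- Only total deficits D ≤ 2 need a check: there are 27 triples, so the bound 18 + 3D on the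
  -- triples left alive is trivial for D ≥ 3.
  checkKilled : List (ℕ × Graph) → Bool
  checkKilled gs =
    all (λ (d , g) → all (λ (d′ , h) → (3 ≤ᵇ d + d′) ∨
      all (λ (d″ , k) → (3 ≤ᵇ d + d′ + d″) ∨
        atLeast (9 ∸ 3 * (d + d′ + d″)) (killed g h k) cells) gs) gs) gs

  -- The 9 is attained at deficit 0: if `g` and `h` both miss a vertex u of the first block, exactly
  -- the nine triples through u are killed.
  checkKilled-true : checkKilled smallDeficit ≡ true
  checkKilled-true = refl

  T-all : {A : Set} {p : A → Bool} {x : A} {xs : List A} → T (all p xs) → x ∈ xs → T (p x)
  T-all {p = p} {xs = xs} h x∈ = All.lookup (All.all⁺ p xs h) x∈

  ≰ᵇ⇒ : ∀ m n {b} → ¬ m ≤ n → T ((m ≤ᵇ n) ∨ b) → T b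
  ≰ᵇ⇒ m n m≰n h with Equivalence.to (T-∨ {m ≤ᵇ n}) h
  ... | inj₁ p = contradiction (≤ᵇ⇒≤ m n p) m≰n
  ... | inj₂ p = p

  false∨⇒ : ∀ {b c} → b ≡ false → T (b ∨ c) → T c
  false∨⇒ refl h = h

  -- For total deficit at least 3, the second summand alone reaches 9. Otherwise each deficit is at
  -- most 2 and the three graphs occur in the checked list. That list is a variable here, so that
  -- its evaluation is confined to `checkKilled-true`.
  killed-many : ∀ gs → checkKilled gs ≡ true → ∀ g h k →
    (∀ x → x ∈ g ∷ h ∷ k ∷ [] → deficit x ≤ 2 → (deficit x , x) ∈ gs) →
    9 ≤ ∑ cells (λ x → 𝟙 (killed g h k x)) + 3 * (deficit g + deficit h + deficit k)
  killed-many gs checked g h k small with 3 ≤? deficit g + deficit h + deficit k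
  ... | yes 3≤D = ≤-trans (*-monoʳ-≤ 3 3≤D) (m≤n+m _ (∑ cells (λ x → 𝟙 (killed g h k x))))
  ... | no  3≰D = begin
      9                        ≤⟨ m≤n+m∸n 9 (3 * D) ⟩
      3 * D + (9 ∸ 3 * D)      ≤⟨ +-monoʳ-≤ (3 * D) (atLeast-∑ _ (killed g h k) cells atLeast-D) ⟩
      3 * D + K                ≡⟨ +-comm (3 * D) K ⟩
      K + 3 * D                ∎
    where
    open ≤-Reasoning
    D = deficit g + deficit h + deficit k
    K = ∑ cells (λ x → 𝟙 (killed g h k x))
    3≰gh : ¬ 3 ≤ deficit g + deficit h
    3≰gh p = 3≰D (≤-trans p (m≤m+n _ _))
    ≤D⇒≤2 : ∀ {d} → d ≤ D → d ≤ 2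
    ≤D⇒≤2 d≤D = ≤-pred (≤-<-trans d≤D (≰⇒> 3≰D))
    g∈ : (deficit g , g) ∈ gs
    g∈ = small g (here refl) (≤D⇒≤2 (≤-trans (m≤m+n _ _) (m≤m+n _ (deficit k))))
    h∈ : (deficit h , h) ∈ gs
    h∈ = small h (there (here refl)) (≤D⇒≤2 (≤-trans (m≤n+m _ (deficit g)) (m≤m+n _ (deficit k))))
    k∈ : (deficit k , k) ∈ gs
    k∈ = small k (there (there (here refl))) (≤D⇒≤2 (m≤n+m _ (deficit g + deficit h)))
    atLeast-D : T (atLeast (9 ∸ 3 * D) (killed g h k) cells)
    atLeast-D = ≰ᵇ⇒ 3 D 3≰D (T-all (≰ᵇ⇒ 3 (deficit g + deficit h) 3≰gh
      (T-all (T-all (Equivalence.from T-≡ checked) g∈) h∈)) k∈)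

  ∈-smallDeficit : ∀ g → hasPM g ≡ false → deficit g ≤ 2 → (deficit g , g) ∈ smallDeficit
  ∈-smallDeficit g pm d≤2 = ∈-filter⁺ (T? ∘ relevant) (∈-map⁺ (λ g → deficit g , g) (∈-graphs g))
    (Equivalence.from (T-∧ {not (hasPM g)}) (Equivalence.from T-not-≡ pm , ≤⇒≤ᵇ d≤2))

  -- By König's theorem, two vertices cover all edges of a graph without perfect matching. So there
  -- are at most six edges, and six only for two full rows or two full columns; any further cell
  -- then completes a perfect matching.
  checkPMFree : List Graph → Bool
  checkPMFree gs = all (λ g → hasPM g ∨ ((size₃₃ g ≤ᵇ 6) ∧
    ((size₃₃ g ≤ᵇ 5) ∨ all (λ a → all (λ b → at g a b ∨ completes g a b) cols) cols))) gs

  checkPMFree-true : checkPMFree graphs ≡ true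
  checkPMFree-true = refl

  ∈-cols : ∀ a → a ∈ cols
  ∈-cols = ∈-allFin

  module PMFree (gs : List Graph) (ok : checkPMFree gs ≡ true)
    (g : Graph) (g∈ : g ∈ gs) (pm : hasPM g ≡ false) where
    private
      checked : T ((size₃₃ g ≤ᵇ 6) ∧
        ((size₃₃ g ≤ᵇ 5) ∨ all (λ a → all (λ b → at g a b ∨ completes g a b) cols) cols))
      checked = false∨⇒ pm (T-all (Equivalence.from T-≡ ok) g∈)

    size₃₃≤6 : size₃₃ g ≤ 6
    size₃₃≤6 = ≤ᵇ⇒≤ _ _ (proj₁ (Equivalence.to (T-∧ {size₃₃ g ≤ᵇ 6}) checked))

    maximal : 6 ≤ size₃₃ g → ∀ a b → at g a b ≡ false → T (completes g a b)
    maximal 6≤ a b ¬ab = false∨⇒ ¬ab (T-all {p = λ b → at g a b ∨ completes g a b}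
      (T-all {p = λ a → all (λ b → at g a b ∨ completes g a b) cols} (≰ᵇ⇒ (size₃₃ g) 5 (<⇒≱ 6≤)
      (proj₂ (Equivalence.to (T-∧ {size₃₃ g ≤ᵇ 6}) checked))) (∈-cols a)) (∈-cols b))

  any-∃ : {A : Set} {p : A → Bool} {xs : List A} → T (any p xs) → ∃[ x ] (x ∈ xs × T (p x))
  any-∃ {p = p} {xs} h = find (Any.any⁻ p xs h)

  -- w a b stands for the number of vertices completing the cell (a , b) to an edge. Three disjoint
  -- cells with at least 1, 3 and 3 such vertices extend to disjoint edges.
  module _ (w : Fin 3 → Fin 3 → ℕ) where

    large : Graph
    large = graph (λ a b → 3 ≤ᵇ w a b)

    large⇒3≤ : ∀ a b → T (at large a b) → 3 ≤ w a b
    large⇒3≤ a b h = ≤ᵇ⇒≤ 3 (w a b) (subst T (at-graph (λ a b → 3 ≤ᵇ w a b) a b) h)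

    ¬large⇒≤2 : ∀ a b → at large a b ≡ false → w a b ≤ 2
    ¬large⇒≤2 a b h = ≤-pred (≰⇒> λ 3≤w → subst T
      (trans (sym (at-graph (λ a b → 3 ≤ᵇ w a b) a b)) h) (≤⇒≤ᵇ 3≤w))

    module _ (no-transversal : ∀ a b {a₁ a₂ b₁ b₂} → (a₁ , a₂) ∈ rest a → (b₁ , b₂) ∈ rest b →
      0 < w a b → 3 ≤ w a₁ b₁ → ¬ 3 ≤ w a₂ b₂) where

      ¬completes : ∀ a b → 0 < w a b → ¬ T (completes large a b)
      ¬completes a b 0<w h
        with (a₁ , a₂) , a∈ , h ← any-∃ {xs = rest a} h
        with (b₁ , b₂) , b∈ , h ← any-∃ {xs = rest b} h
        with h₁ , h₂ ← Equivalence.to (T-∧ {at large a₁ b₁}) h =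
        no-transversal a b a∈ b∈ 0<w (large⇒3≤ a₁ b₁ h₁) (large⇒3≤ a₂ b₂ h₂)

      large-PMfree : hasPM large ≡ false
      large-PMfree = ¬-not λ h → let open Equivalence in
        let b , _ , h = any-∃ {p = λ b → at large 0F b ∧ completes large 0F b} {cols} (from T-≡ h)
            h₁ , h₂ = to (T-∧ {at large 0F b}) h
        in ¬completes 0F b (≤-trans (s≤s z≤n) (large⇒3≤ 0F b h₁)) h₂

      private
        open module LargePMFree = PMFree graphs checkPMFree-true large (∈-graphs large) large-PMfree

        scale : ∀ x → ∑ cols (λ a → ∑ cols (λ b → x * 𝟙 (at large a b))) ≡ x * size₃₃ large
        scale x = trans (∑-cong cols λ a → ∑-*ˡ cols x (λ b → 𝟙 (at large a b)))
          (∑-*ˡ cols x (λ a → ∑ cols (λ b → 𝟙 (at large a b))))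

      -- With six large cells every other cell is 0, since by `maximal` it would complete two large
      -- ones to a transversal. With N ≤ 5 large cells the others are at most 2 each, which gives
      -- N(8 + c) + 2(9 - N) + c(6 - N) = 6N + 18 + 6c in all. For N = 5 this is exactly 6(8 + c),
      -- and here the 8 originates.
      cells-bound : ∀ {c} → (∀ a b → w a b ≤ 8 + c) →
        ∑ cols (λ a → ∑ cols (w a)) + c * deficit large ≤ 6 * (8 + c)
      cells-bound {c} w≤ with 6 ≤? size₃₃ large
      ... | yes 6≤ = begin
        ∑ cols (λ a → ∑ cols (w a)) + c * (6 ∸ N)
          ≡⟨ cong (λ d → ∑ cols (λ a → ∑ cols (w a)) + c * d) (m≤n⇒m∸n≡0 6≤) ⟩
        ∑ cols (λ a → ∑ cols (w a)) + c * 0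
          ≤⟨ +-monoˡ-≤ (c * 0) (∑-mono cols λ a → ∑-mono cols (cell a)) ⟩
        ∑ cols (λ a → ∑ cols (λ b → (8 + c) * 𝟙 (at large a b))) + c * 0
          ≡⟨ cong₂ _+_ (scale (8 + c)) (*-zeroʳ c) ⟩
        (8 + c) * N + 0
          ≡⟨ +-identityʳ _ ⟩
        (8 + c) * N
          ≤⟨ *-monoʳ-≤ (8 + c) (size₃₃≤6) ⟩
        (8 + c) * 6
          ≡⟨ *-comm (8 + c) 6 ⟩
        6 * (8 + c) ∎
        where
        open ≤-Reasoning
        N = size₃₃ large
        cell : ∀ a b → w a b ≤ (8 + c) * 𝟙 (at large a b)
        cell a b with at large a b in eq
        ... | true  = ≤-trans (w≤ a b) (≤-reflexive (sym (*-identityʳ (8 + c))))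
        ... | false = ≤-trans (≮⇒≥ λ 0<w → ¬completes a b 0<w (maximal 6≤ a b eq)) z≤n
      ... | no 6≰ = begin
        ∑ cols (λ a → ∑ cols (w a)) + c * (6 ∸ N)
          ≤⟨ +-monoˡ-≤ (c * (6 ∸ N)) (∑-mono cols λ a → ∑-mono cols (cell a)) ⟩
        ∑ cols (λ a → ∑ cols (λ b → (6 + c) * 𝟙 (at large a b) + 2)) + c * (6 ∸ N)
          ≡⟨ cong (_+ c * (6 ∸ N)) sum ⟩
        (6 + c) * N + 18 + c * (6 ∸ N)
          ≡⟨ regroup c N (6 ∸ N) ⟩
        6 * N + 18 + c * (N + (6 ∸ N))
          ≡⟨ cong (λ x → 6 * N + 18 + c * x) (m+[n∸m]≡n (<⇒≤ (≰⇒> 6≰))) ⟩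
        6 * N + 18 + c * 6
          ≤⟨ +-monoˡ-≤ (c * 6) (+-monoˡ-≤ 18 (*-monoʳ-≤ 6 (≤-pred (≰⇒> 6≰)))) ⟩
        48 + c * 6
          ≡⟨ expand c ⟩
        6 * (8 + c) ∎
        where
        open ≤-Reasoning
        N = size₃₃ large
        cell : ∀ a b → w a b ≤ (6 + c) * 𝟙 (at large a b) + 2
        cell a b with at large a b in eq
        ... | true  = ≤-trans (w≤ a b) (≤-reflexive (slack c))
          where
          slack : ∀ c → 8 + c ≡ (6 + c) * 1 + 2
          slack = solve-∀
        ... | false = ≤-trans (¬large⇒≤2 a b eq) (m≤n+m _ _)
        sum : ∑ cols (λ a → ∑ cols (λ b → (6 + c) * 𝟙 (at large a b) + 2)) ≡ (6 + c) * N + 18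
        sum = trans (∑-cong cols λ a → ∑-+ cols (λ b → (6 + c) * 𝟙 (at large a b)) (λ _ → 2))
          (trans (∑-+ cols (λ a → ∑ cols (λ b → (6 + c) * 𝟙 (at large a b))) (λ _ → 6))
            (cong (_+ 18) (scale (6 + c))))
        regroup : ∀ c N d → (6 + c) * N + 18 + c * d ≡ 6 * N + 18 + c * (N + d)
        regroup = solve-∀
        expand : ∀ c → 48 + c * 6 ≡ 6 * (8 + c)
        expand = solve-∀

  -- Let D be the total deficit. At most 18 + 3D triples survive, and after multiplication by `m`
  -- the excess 3mD = (2 + c)D is paid for by the deficits except for 2D ≤ 6, if D ≤ 3. For D ≥ 3
  -- the trivial bound 27 agrees with the bound at D = 3. The factor `m` stands for the number of
  -- triples among which a pair divides its saving.
  triples-bound : ∀ {m c} g₁₂ g₁₃ g₂₃ (t : Fin 3 × Fin 3 × Fin 3 → ℕ) → 3 * m ≡ 2 + c →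
    hasPM g₁₂ ≡ false → hasPM g₁₃ ≡ false → hasPM g₂₃ ≡ false → (∀ x → t x ≤ 1) →
    (∀ x → T (killed g₁₂ g₁₃ g₂₃ x) → t x ≡ 0) →
    m * ∑ cells t ≤ 18 * m + 6 + (c * deficit g₁₂ + c * deficit g₁₃ + c * deficit g₂₃)
  triples-bound {m} {c} g₁₂ g₁₃ g₂₃ t 3m≡ p₁₂ p₁₃ p₂₃ t≤1 t-killed = ≤-trans main
    (≤-reflexive (cong (18 * m + 6 +_) (distrib c (deficit g₁₂) (deficit g₁₃) (deficit g₂₃))))
    where
    open ≤-Reasoning
    D = deficit g₁₂ + deficit g₁₃ + deficit g₂₃
    K = ∑ cells (λ x → 𝟙 (killed g₁₂ g₁₃ g₂₃ x))
    distrib : ∀ c x y z → c * (x + y + z) ≡ c * x + c * y + c * z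
    distrib = solve-∀
    t+K≤27 : ∑ cells t + K ≤ 27
    t+K≤27 = begin
      ∑ cells t + K  ≡⟨ ∑-+ cells t (λ x → 𝟙 (killed g₁₂ g₁₃ g₂₃ x)) ⟨
      ∑ cells (λ x → t x + 𝟙 (killed g₁₂ g₁₃ g₂₃ x))  ≤⟨ ∑-mono cells bound ⟩
      ∑ cells (λ _ → 1)  ≡⟨⟩
      27 ∎
      where
      bound : ∀ x → t x + 𝟙 (killed g₁₂ g₁₃ g₂₃ x) ≤ 1
      bound x with killed g₁₂ g₁₃ g₂₃ x | t-killed x
      ... | true  | tk rewrite tk tt = ≤-refl
      ... | false | _  = ≤-trans (≤-reflexive (+-identityʳ (t x))) (t≤1 x)
    9≤K+3D : 9 ≤ K + 3 * D
    9≤K+3D = killed-many smallDeficit checkKilled-true g₁₂ g₁₃ g₂₃ λ where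
      x (here refl)                 → ∈-smallDeficit x p₁₂
      x (there (here refl))         → ∈-smallDeficit x p₁₃
      x (there (there (here refl))) → ∈-smallDeficit x p₂₃
    t≤18+3D : ∑ cells t ≤ 18 + 3 * D
    t≤18+3D = +-cancelʳ-≤ 9 _ _ (begin
      ∑ cells t + 9               ≤⟨ +-monoʳ-≤ (∑ cells t) 9≤K+3D ⟩
      ∑ cells t + (K + 3 * D)     ≡⟨ +-assoc (∑ cells t) K (3 * D) ⟨
      ∑ cells t + K + 3 * D       ≤⟨ +-monoˡ-≤ (3 * D) t+K≤27 ⟩
      27 + 3 * D                  ≡⟨ shift (3 * D) ⟩
      18 + 3 * D + 9              ∎)
      where
      shift : ∀ d → 27 + d ≡ 18 + d + 9
      shift = solve-∀
    main : m * ∑ cells t ≤ 18 * m + 6 + c * D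
    main with ≤-total D 3
    ... | inj₁ D≤3 = begin
      m * ∑ cells t             ≤⟨ *-monoʳ-≤ m t≤18+3D ⟩
      m * (18 + 3 * D)          ≡⟨ expand m D ⟩
      18 * m + 3 * m * D        ≡⟨ cong (λ x → 18 * m + x * D) 3m≡ ⟩
      18 * m + (2 + c) * D      ≡⟨ expand′ m c D ⟩
      18 * m + 2 * D + c * D    ≤⟨ +-monoˡ-≤ (c * D) (+-monoʳ-≤ (18 * m) (*-monoʳ-≤ 2 D≤3)) ⟩
      18 * m + 6 + c * D        ∎
      where
      expand : ∀ m D → m * (18 + 3 * D) ≡ 18 * m + 3 * m * D
      expand = solve-∀
      expand′ : ∀ m c D → 18 * m + (2 + c) * D ≡ 18 * m + 2 * D + c * D
      expand′ = solve-∀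
    ... | inj₂ 3≤D = begin
      m * ∑ cells t             ≤⟨ *-monoʳ-≤ m (≤-trans (m≤m+n _ K) t+K≤27) ⟩
      m * 27                    ≡⟨ expand m ⟩
      18 * m + 3 * m * 3        ≡⟨ cong (λ x → 18 * m + x * 3) 3m≡ ⟩
      18 * m + (2 + c) * 3      ≡⟨ expand′ m c ⟩
      18 * m + 6 + c * 3        ≤⟨ +-monoʳ-≤ (18 * m + 6) (*-monoʳ-≤ c 3≤D) ⟩
      18 * m + 6 + c * D        ∎
      where
      expand : ∀ m → m * 27 ≡ 18 * m + 3 * m * 3
      expand = solve-∀
      expand′ : ∀ m c → 18 * m + (2 + c) * 3 ≡ 18 * m + 6 + c * 3
      expand′ = solve-∀

-- Systems of triples and the exchange argument.

module TripleSystems where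
  open Sums
  open BipartiteGraphs
  open import Data.Bool using (T)
  open import Data.Bool.Properties using (T-∧)
  open import Data.Fin using (Fin; zero; suc; _≟_)
  open import Data.Fin.Patterns using (0F; 1F; 2F; 3F; 4F)
  open import Data.Nat
    using (ℕ; zero; suc; _+_; _*_; _≤_; _<_; z≤n; _≤?_; _<?_; s<s; z<s; >-nonZero)
  open import Data.Nat.Properties hiding (_≟_)
  open import Data.Nat.Tactic.RingSolver using (solve-∀)
  open import Data.List
    using (List; []; _∷_; _++_; map; filter; concatMap; length; allFin; lookup; cartesianProduct)
  open import Data.List.Properties using (length-++; length-map; length-tabulate; concatMap-++)
  open import Data.List.Membership.Propositional using (_∈_; _∉_; find; lose)
  open import Data.List.Membership.Propositional.Properties
    using (∈-filter⁺; ∈-filter⁻; ∈-map⁻; ∈-lookup; ∈-++⁺ˡ; ∈-++⁺ʳ)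
  import Data.List.Membership.DecPropositional as DecMembership
  import Data.List.Relation.Binary.Disjoint.Propositional as List
  open import Data.List.Relation.Unary.All as All using (All; []; _∷_; all?)
  import Data.List.Relation.Unary.All.Properties as All
  open import Data.List.Relation.Unary.AllPairs using ([]; _∷_)
  open import Data.List.Relation.Unary.Any using (here; there; any?)
  open import Data.List.Relation.Unary.Unique.Propositional using (Unique)
  import Data.List.Relation.Unary.Unique.Propositional.Properties as Unique
  import Data.List.Relation.Unary.Unique.DecPropositional as DecUnique
  open import Data.Product using (_×_; _,_; proj₁; proj₂; ∃-syntax)
  open import Data.Product.Properties using (≡-dec)
  open import Data.Sum using (_⊎_; inj₁; inj₂)
  import Data.Sum.Properties as Sum
  open import Function using (_∘_; Equivalence)
  open import Relation.Binary.Definitions using (DecidableEquality)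
  open import Relation.Binary.PropositionalEquality
  open import Relation.Nullary using (Dec; yes; no; ¬_; contradiction; does; ¬?)
  open import Relation.Nullary.Decidable
    using (_×-dec_; from-yes; decidable-stable; True; toWitness)

  private
    variable
      A : Set

  Triple : Set → Set
  Triple A = A × A × A

  verts : Triple A → List A
  verts (x , y , z) = x ∷ y ∷ z ∷ []

  mapTriple : ∀ {A B : Set} → (A → B) → Triple A → Triple B
  mapTriple f (x , y , z) = f x , f y , f z

  lookup-injective : {xs : List A} → Unique xs → ∀ {i j} → lookup xs i ≡ lookup xs j → i ≡ j
  lookup-injective {xs = x ∷ xs} (x∉ ∷ u) {zero}  {zero}  eq = refl
  lookup-injective {xs = x ∷ xs} (x∉ ∷ u) {zero}  {suc j} eq =
    contradiction eq (All.lookup x∉ (∈-lookup j))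
  lookup-injective {xs = x ∷ xs} (x∉ ∷ u) {suc i} {zero}  eq =
    contradiction (sym eq) (All.lookup x∉ (∈-lookup i))
  lookup-injective {xs = x ∷ xs} (x∉ ∷ u) {suc i} {suc j} eq = cong suc (lookup-injective u eq)

  -- (r , c) is the vertex c of the r-th of `rows` edges of a matching,
  -- the other summand lists vertices outside the matching.
  Label : ℕ → ℕ → Set
  Label rows outs = (Fin rows × Fin 3) ⊎ Fin outs

  pattern ι r c = inj₁ (r , c)
  pattern ω l = inj₂ l

  _≟ᴸ_ : ∀ {r o} → DecidableEquality (Label r o)
  _≟ᴸ_ = Sum.≡-dec (≡-dec _≟_ _≟_) _≟_

  -- Disjointness of the new edges in an exchange is decided on labels, by evaluation, and
  -- transported to the vertices by `vertex-injective`.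
  Separate : ∀ {r o} → List (Triple (Label r o)) → Set
  Separate ts = Unique (concatMap verts ts)

  separate? : ∀ {r o} (ts : List (Triple (Label r o))) → Dec (Separate ts)
  separate? ts = DecUnique.unique? _≟ᴸ_ (concatMap verts ts)

  -- A 3-graph with matching number s and codegrees at most 3s, a maximum matching v, and a list O
  -- of vertices outside of it.
  record System (n s : ℕ) : Set₁ where
    field
      Edge      : Fin n → Fin n → Fin n → Set
      edge?     : ∀ x y z → Dec (Edge x y z)
      swap₁₂    : ∀ {x y z} → Edge x y z → Edge y x z
      swap₂₃    : ∀ {x y z} → Edge x y z → Edge x z y
      distinct  : ∀ {x y z} → Edge x y z → x ≢ y
      matching≤ : ∀ ts → Unique (concatMap verts ts) → All (λ (x , y , z) → Edge x y z) ts →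
                  length ts ≤ s
      cocover   : ∀ x y → ∃[ C ] (length C ≡ 3 * s × (∀ {z} → Edge x y z → z ∈ C))
      v         : Fin s → Fin 3 → Fin n
      v-inj     : ∀ {i j a b} → v i a ≡ v j b → (i , a) ≡ (j , b)
      v-edge    : ∀ i → Edge (v i 0F) (v i 1F) (v i 2F)
      O         : List (Fin n)
      O-unique  : Unique O
      O-outside : ∀ {i a} → v i a ∉ O

  module Local {n s : ℕ} (S : System n s) where
    open System S
    open DecMembership (_≟_ {n}) using (_∈?_)

    e : Fin n → Fin n → Fin n → ℕ
    e x y z = 𝟙 (does (edge? x y z))

    e≤1 : ∀ x y z → e x y z ≤ 1
    e≤1 x y z with edge? x y z
    ... | yes _ = ≤-refl
    ... | no  _ = z≤n

    e⇒Edge : ∀ {x y z} → 0 < e x y z → Edge x y z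
    e⇒Edge {x} {y} {z} 0<e with edge? x y z
    ... | yes p = p

    e≡0 : ∀ {x y z} → ¬ Edge x y z → e x y z ≡ 0
    e≡0 {x} {y} {z} ¬p with edge? x y z
    ... | yes p = contradiction p ¬p
    ... | no  _ = refl

    e-cong : ∀ {x y z x′ y′ z′} → (Edge x y z → Edge x′ y′ z′) → (Edge x′ y′ z′ → Edge x y z) →
      e x y z ≡ e x′ y′ z′
    e-cong {x} {y} {z} {x′} {y′} {z′} to from with edge? x y z | edge? x′ y′ z′
    ... | yes _ | yes _ = refl
    ... | no _  | no _  = refl
    ... | yes p | no ¬q = contradiction (to p) ¬q
    ... | no ¬p | yes q = contradiction (from q) ¬p

    N : Fin n → Fin n → ℕ
    N x y = ∑ O (e x y)

    G : Fin n → ℕ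
    G x = ∑₂ O (e x)

    N-sym : ∀ x y → N x y ≡ N y x
    N-sym x y = ∑-cong O (λ z → e-cong swap₁₂ swap₁₂)

    codegree : ∀ {L} → Unique L → ∀ x y → ∑ L (e x y) ≤ 3 * s
    codegree u x y with C , len , cov ← cocover x y =
      ≤-trans (∑-support u (e≤1 x y) (λ _ → cov ∘ e⇒Edge)) (≤-reflexive len)

    N≤3s : ∀ x y → N x y ≤ 3 * s
    N≤3s = codegree O-unique

    link-cover : ∀ {L C} x → Unique L →
      (∀ {y z} → y ∈ L → z ∈ L → Edge x y z → y ∈ C ⊎ z ∈ C) →
      ∑₂ L (e x) ≤ ∑ C (λ c → ∑ L (e x c))
    link-cover x u cov =
      ∑₂-cover _≟_ u (λ y z → e-cong swap₂₃ swap₂₃) (λ y∈ z∈ → cov y∈ z∈ ∘ e⇒Edge)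

    link-cover-length : ∀ {L C} x → Unique L →
      (∀ {y z} → y ∈ L → z ∈ L → Edge x y z → y ∈ C ⊎ z ∈ C) → ∑₂ L (e x) ≤ length C * (3 * s)
    link-cover-length {L} {C} x u cov = ≤-trans (link-cover x u cov)
      (≤-trans (∑-mono C (λ c → codegree u x c)) (≤-reflexive (∑-const C (3 * s))))

    pick : ∀ x y D → length D < N x y → ∃[ z ] (z ∈ O × Edge x y z × z ∉ D)
    pick x y D D< with any? (λ z → edge? x y z ×-dec ¬? (z ∈? D)) O
    ... | yes p with z , z∈ , E , z∉ ← find p = z , z∈ , E , z∉
    ... | no ¬p = contradiction (∑-support O-unique (e≤1 x y) supp) (<⇒≱ D<)
      where
      supp : ∀ {z} → z ∈ O → 0 < e x y z → z ∈ D
      supp {z} z∈ 0<e = decidable-stable (z ∈? D) λ z∉ → ¬p (lose z∈ (e⇒Edge 0<e , z∉))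

    -- Otherwise `C` covers the link of `x` in `O`, and each vertex of `C` accounts for at most 3s
    -- of its edges.
    pick₂ : ∀ x C → length C * (3 * s) < G x →
      ∃[ y ] ∃[ z ] (y ∈ O × z ∈ O × Edge x y z × y ∉ C × z ∉ C)
    pick₂ x C C< with any? (λ y → any? (λ z → edge? x y z ×-dec ¬? (y ∈? C) ×-dec ¬? (z ∈? C)) O) O
    ... | yes p with y , y∈ , q ← find p with z , z∈ , E , y∉ , z∉ ← find q =
      y , z , y∈ , z∈ , E , y∉ , z∉
    ... | no ¬p = contradiction (link-cover-length x O-unique cov) (<⇒≱ C<)
      where
      cov : ∀ {y z} → y ∈ O → z ∈ O → Edge x y z → y ∈ C ⊎ z ∈ C
      cov {y} {z} y∈ z∈ E with y ∈? C | z ∈? C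
      ... | yes y∈C | _       = inj₁ y∈C
      ... | no _    | yes z∈C = inj₂ z∈C
      ... | no y∉   | no z∉   = contradiction (lose y∈ (lose z∈ (E , y∉ , z∉))) ¬p

    link-distinct : ∀ {x y z} → Edge x y z → y ≢ z
    link-distinct = distinct ∘ swap₂₃ ∘ swap₁₂

    -- The link of y is covered by an edge {a , b} of the link of x; those of its edges that contain
    -- a also meet an edge of the link of x avoiding a.
    cross-intersecting : ∀ x y → 3 * s < G x →
      (∀ {a b c d} → a ∈ O → b ∈ O → c ∈ O → d ∈ O → Edge x a b → Edge y c d →
        ¬ Unique (a ∷ b ∷ c ∷ d ∷ [])) → G y ≤ 4
    cross-intersecting x y big meet
      with a , b , a∈ , b∈ , Exab , _ ← pick₂ x [] (≤-<-trans z≤n big) =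
      ≤-trans (link-cover y O-unique (λ c∈ d∈ E → meets (a∈ , b∈ , Exab) c∈ d∈ E))
        (+-mono-≤ (star a∈) (+-mono-≤ (star b∈) z≤n))
      where
      meets : ∀ {a b c d} → a ∈ O × b ∈ O × Edge x a b → c ∈ O → d ∈ O → Edge y c d →
        c ∈ a ∷ b ∷ [] ⊎ d ∈ a ∷ b ∷ []
      meets {a} {b} {c} {d} (a∈ , b∈ , Ex) c∈ d∈ Ey with c ∈? a ∷ b ∷ [] | d ∈? a ∷ b ∷ []
      ... | yes p | _     = inj₁ p
      ... | no _  | yes q = inj₂ q
      ... | no ¬p | no ¬q = contradiction
        ((link-distinct Ex ∷ (¬p ∘ here ∘ sym) ∷ (¬q ∘ here ∘ sym) ∷ [])
          ∷ ((¬p ∘ there ∘ here ∘ sym) ∷ (¬q ∘ there ∘ here ∘ sym) ∷ [])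
          ∷ (link-distinct Ey ∷ []) ∷ [] ∷ [])
        (meet a∈ b∈ c∈ d∈ Ex Ey)
      star : ∀ {c} → c ∈ O → N y c ≤ 2
      star {c} c∈ with p , q , p∈ , q∈ , E , p∉ , q∉ ← pick₂ x (c ∷ [])
                         (subst (_< G x) (sym (+-identityʳ (3 * s))) big) =
        ∑-support O-unique (e≤1 y c) supp
        where
        supp : ∀ {d} → d ∈ O → 0 < e y c d → d ∈ p ∷ q ∷ []
        supp d∈ 0<e with meets (p∈ , q∈ , E) c∈ d∈ (e⇒Edge 0<e)
        ... | inj₂ d∈pq                = d∈pq
        ... | inj₁ (here refl)         = contradiction (here refl) p∉
        ... | inj₁ (there (here refl)) = contradiction (here refl) q∉

    module _ (is : List (Fin s)) (os : List (Fin n)) where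

      vertex : Label (length is) (length os) → Fin n
      vertex (inj₁ (r , c)) = v (lookup is r) c
      vertex (inj₂ l)       = lookup os l

      vertex-injective : Unique is → Unique os → All (_∈ O) os →
        ∀ {l l′} → vertex l ≡ vertex l′ → l ≡ l′
      vertex-injective ui uo os∈ {inj₁ (r , c)} {inj₁ (r′ , c′)} eq
        with eq′ ← v-inj eq
        with refl ← lookup-injective ui (cong proj₁ eq′) | refl ← cong proj₂ eq′ = refl
      vertex-injective ui uo os∈ {inj₁ _} {inj₂ l} eq =
        contradiction (subst (_∈ O) (sym eq) (All.lookup os∈ (∈-lookup l))) O-outside
      vertex-injective ui uo os∈ {inj₂ l} {inj₁ _} eq =
        contradiction (subst (_∈ O) eq (All.lookup os∈ (∈-lookup l))) O-outside
      vertex-injective ui uo os∈ {inj₂ l} {inj₂ l′} eq = cong inj₂ (lookup-injective uo eq)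

      -- The new edges and the edges of the matching with index outside `is` form a matching
      -- together, so they number at most s.
      exchange : Unique is → Unique os → All (_∈ O) os →
        (ts : List (Triple (Label (length is) (length os)))) → Separate ts →
        All (λ (a , b , c) → Edge (vertex a) (vertex b) (vertex c)) ts → length ts ≤ length is
      exchange ui uo os∈ ts sep edges = +-cancelʳ-≤ (length js) _ _ (begin
        length ts + length js          ≡⟨ cong₂ _+_ (length-map (mapTriple vertex) ts)
                                            (length-map block js) ⟨
        length new + length old        ≡⟨ length-++ new ⟨
        length (new ++ old)            ≤⟨ matching≤ (new ++ old) unique all-edges ⟩
        s                              ≡⟨ length-tabulate _ ⟨
        length (allFin s)              ≤⟨ length-⊆ (Unique.allFin⁺ s) split ⟩
        length (is ++ js)              ≡⟨ length-++ is ⟩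
        length is + length js          ∎)
        where
        open ≤-Reasoning
        open DecMembership (_≟_ {s}) using () renaming (_∈?_ to _∈ˢ?_)
        js : List (Fin s)
        js = filter (λ j → ¬? (j ∈ˢ? is)) (allFin s)
        block : Fin s → Triple (Fin n)
        block j = v j 0F , v j 1F , v j 2F
        new old : List (Triple (Fin n))
        new = map (mapTriple vertex) ts
        old = map block js
        split : ∀ {j} → j ∈ allFin s → j ∈ is ++ js
        split {j} j∈ with j ∈ˢ? is
        ... | yes p = ∈-++⁺ˡ p
        ... | no ¬p = ∈-++⁺ʳ is (∈-filter⁺ (λ j → ¬? (j ∈ˢ? is)) j∈ ¬p)
        concat-new : ∀ ts → concatMap verts (map (mapTriple vertex) ts) ≡ map vertex (concatMap verts ts)
        concat-new []       = refl
        concat-new (t ∷ ts) = cong (λ l → _ ∷ _ ∷ _ ∷ l) (concat-new ts)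
        ∈-new : ∀ {x} → x ∈ concatMap verts new → ∃[ l ] x ≡ vertex l
        ∈-new x∈ with l , _ , eq ← ∈-map⁻ vertex (subst (_ ∈_) (concat-new ts) x∈) = l , eq
        ∈-old : ∀ {x} ks → x ∈ concatMap verts (map block ks) → ∃[ j ] ∃[ c ] (j ∈ ks × x ≡ v j c)
        ∈-old (k ∷ ks) (here eq)                 = k , 0F , here refl , eq
        ∈-old (k ∷ ks) (there (here eq))         = k , 1F , here refl , eq
        ∈-old (k ∷ ks) (there (there (here eq))) = k , 2F , here refl , eq
        ∈-old (k ∷ ks) (there (there (there p)))
          with j , c , j∈ , eq ← ∈-old ks p = j , c , there j∈ , eq
        old-unique : ∀ ks → Unique ks → Unique (concatMap verts (map block ks))
        old-unique []       _        = []
        old-unique (k ∷ ks) (k∉ ∷ u) = Unique.++⁺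
          ((≢ (λ ()) ∷ ≢ (λ ()) ∷ []) ∷ (≢ (λ ()) ∷ []) ∷ [] ∷ [])
          (old-unique ks u) disj
          where
          ≢ : ∀ {a b} → a ≢ b → v k a ≢ v k b
          ≢ a≢b eq = a≢b (cong proj₂ (v-inj eq))
          disj : List.Disjoint (verts (block k)) (concatMap verts (map block ks))
          disj (p , q) with j , c , j∈ , refl ← ∈-old ks q = All.lookup k∉ j∈ (same p)
            where
            same : ∀ {j c} → v j c ∈ verts (block k) → k ≡ j
            same (here eq)                 = sym (cong proj₁ (v-inj eq))
            same (there (here eq))         = sym (cong proj₁ (v-inj eq))
            same (there (there (here eq))) = sym (cong proj₁ (v-inj eq))
        unique : Unique (concatMap verts (new ++ old))
        unique = subst Unique (sym (concatMap-++ verts new old)) (Unique.++⁺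
          (subst Unique (sym (concat-new ts)) (Unique.map⁺ (vertex-injective ui uo os∈) sep))
          (old-unique js (Unique.filter⁺ _ (Unique.allFin⁺ s))) disj)
          where
          disj : List.Disjoint (concatMap verts new) (concatMap verts old)
          disj (p , q) with l , refl ← ∈-new p with j , c , j∈ , eq ← ∈-old js q with l
          ... | inj₁ (r , _) = proj₂ (∈-filter⁻ (λ j → ¬? (j ∈ˢ? is)) {xs = allFin s} j∈)
            (subst (_∈ is) (cong proj₁ (v-inj eq)) (∈-lookup r))
          ... | inj₂ o = O-outside (subst (_∈ O) eq (All.lookup os∈ (∈-lookup o)))
        all-edges : All (λ (x , y , z) → Edge x y z) (new ++ old)
        all-edges = All.++⁺ (All.map⁺ edges) (All.map⁺ (All.tabulate (λ {j} _ → v-edge j)))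

  -- Three edges for two: vertex 0 of the first old edge with an edge of its link, and two disjoint
  -- cells avoiding this vertex.
  twoCells : Fin 3 × Fin 3 → Fin 3 × Fin 3 → List (Triple (Label 2 4))
  twoCells (a₁ , a₂) (b₁ , b₂) =
    (ι 0F 0F , ω 0F , ω 1F) ∷ (ι 0F a₁ , ι 1F b₁ , ω 2F) ∷ (ι 0F a₂ , ι 1F b₂ , ω 3F) ∷ []

  separate-twoCells : All (λ a → All (λ b → All (λ b′ →
    Separate (twoCells a b′)) (rest b)) cols) (rest 0F)
  separate-twoCells = from-yes
    (all? (λ a → all? (λ b → all? (λ b′ → separate? (twoCells a b′)) (rest b)) cols) (rest 0F))

  transversal : Fin 3 → Fin 3 × Fin 3 → Fin 3 → Fin 3 × Fin 3 → List (Triple (Label 2 3))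
  transversal a (a₁ , a₂) b (b₁ , b₂) =
    (ι 0F a , ι 1F b , ω 0F) ∷ (ι 0F a₁ , ι 1F b₁ , ω 1F) ∷ (ι 0F a₂ , ι 1F b₂ , ω 2F) ∷ []

  separate-transversal : All (λ a → All (λ a′ → All (λ b → All (λ b′ →
    Separate (transversal a a′ b b′)) (rest b)) cols) (rest a)) cols
  separate-transversal = from-yes (all? (λ a → all? (λ a′ → all? (λ b → all? (λ b′ →
    separate? (transversal a a′ b b′)) (rest b)) cols) (rest a)) cols)

  -- Four edges for three; the cells are arranged as in `killed`.
  tripleAndCells : Fin 3 → Fin 3 × Fin 3 → Fin 3 → Fin 3 × Fin 3 → Fin 3 → Fin 3 × Fin 3 →
    List (Triple (Label 3 3))
  tripleAndCells a (a₁ , a₂) b (b₁ , b₂) c (c₁ , c₂) = (ι 0F a , ι 1F b , ι 2F c)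
    ∷ (ι 0F a₁ , ι 1F b₁ , ω 0F) ∷ (ι 0F a₂ , ι 2F c₁ , ω 1F) ∷ (ι 1F b₂ , ι 2F c₂ , ω 2F) ∷ []

  separate-tripleAndCells : All (λ a → All (λ a′ → All (λ b → All (λ b′ → All (λ c → All (λ c′ →
    Separate (tripleAndCells a a′ b b′ c c′)) (rest c)) cols) (rest b)) cols) (rest a)) cols
  separate-tripleAndCells = from-yes (all? (λ a → all? (λ a′ → all? (λ b → all? (λ b′ →
    all? (λ c → all? (λ c′ →
    separate? (tripleAndCells a a′ b b′ c c′)) (rest c)) cols) (rest b)) cols) (rest a)) cols)

  -- Local estimates by exchanging one, two or three edges.

  module LocalBounds {n s : ℕ} (S : System n s) (3≤s : 3 ≤ s) where
    open System S
    open Local S public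
    open DecMembership (_≟_ {n}) using (_∈?_)

    -- Only vertex 0 is tested: `relabelled` later moves a vertex of large degree to this place.
    Big : Fin s → Set
    Big i = 3 * s < G (v i 0F)

    Low : Fin s → Set
    Low i = ∀ c → G (v i c) ≤ 3 * s

    9≤3s : 9 ≤ 3 * s
    9≤3s = *-monoʳ-≤ 3 3≤s

    ∉-swap : ∀ {x : Fin n} {ys} → x ∉ ys → All (x ≢_) ys
    ∉-swap {ys = []}     x∉ = []
    ∉-swap {ys = y ∷ ys} x∉ = (x∉ ∘ here) ∷ ∉-swap (x∉ ∘ there)

    pick-avoiding : ∀ {x} y → 3 * s < G x →
      ∃[ a ] ∃[ b ] (a ∈ O × b ∈ O × Edge x a b × y ≢ a × y ≢ b)
    pick-avoiding {x} y big
      with a , b , a∈ , b∈ , E , a∉ , b∉ ← pick₂ x (y ∷ [])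
                         (subst (_< G x) (sym (+-identityʳ (3 * s))) big) =
      a , b , a∈ , b∈ , E , a∉ ∘ here ∘ sym , b∉ ∘ here ∘ sym

    uniq₁ : {i : Fin s} → Unique (i ∷ [])
    uniq₁ = [] ∷ []

    uniq₂ : ∀ {i j : Fin s} → i ≢ j → Unique (i ∷ j ∷ [])
    uniq₂ i≢j = (i≢j ∷ []) ∷ [] ∷ []

    -- If the link of `v i c₃` has an edge {a , b} in `O`, every vertex completing the other two is
    -- a or b, or else two edges would replace one. If it has none, the codegree bound suffices. The
    -- argument `sep` is found by evaluation once the positions are concrete.
    low-cell : ∀ i c₁ c₂ c₃
      {sep : True (separate? {1} {3} ((ι 0F c₁ , ι 0F c₂ , ω 0F) ∷ (ι 0F c₃ , ω 1F , ω 2F) ∷ []))} →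
      Low i →
      N (v i c₁) (v i c₂) + G (v i c₃) ≤ 2 + 3 * s
    low-cell i c₁ c₂ c₃ {sep} low with 0 <? G (v i c₃)
    ... | no ¬p rewrite n≤0⇒n≡0 (≮⇒≥ ¬p) | +-identityʳ (N (v i c₁) (v i c₂)) =
      ≤-trans (N≤3s _ _) (m≤n+m _ 2)
    ... | yes p with a , b , a∈ , b∈ , E , _ ← pick₂ (v i c₃) [] p =
      +-mono-≤ (∑-support O-unique (e≤1 _ _) supp) (low c₃)
      where
      supp : ∀ {z} → z ∈ O → 0 < e (v i c₁) (v i c₂) z → z ∈ a ∷ b ∷ []
      supp {z} z∈ 0<e = decidable-stable (z ∈? a ∷ b ∷ []) λ z∉ → <⇒≱ ≤-refl
        (exchange (i ∷ []) (z ∷ a ∷ b ∷ []) uniq₁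
          (∉-swap z∉ ∷ (link-distinct E ∷ []) ∷ [] ∷ []) (z∈ ∷ a∈ ∷ b∈ ∷ [])
          _ (toWitness sep) (e⇒Edge 0<e ∷ E ∷ []))

    -- A vertex z completing vertices 1 and 2 leaves an edge in the link of vertex 0 that avoids z:
    -- two disjoint edges for one.
    big-cell : ∀ i → Big i → N (v i 1F) (v i 2F) ≡ 0
    big-cell i big = n≤0⇒n≡0 (≮⇒≥ λ 0<N →
      let ts = (ι 0F 1F , ι 0F 2F , ω 0F) ∷ (ι 0F 0F , ω 1F , ω 2F) ∷ []
          z , z∈ , E , _ = pick _ _ [] 0<N
          a , b , a∈ , b∈ , E′ , z≢a , z≢b = pick-avoiding z big
      in <⇒≱ ≤-refl (exchange (i ∷ []) (z ∷ a ∷ b ∷ []) uniq₁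
          ((z≢a ∷ z≢b ∷ []) ∷ (link-distinct E′ ∷ []) ∷ [] ∷ []) (z∈ ∷ a∈ ∷ b∈ ∷ [])
          ts (from-yes (separate? ts)) (E ∷ E′ ∷ [])))

    big-link : ∀ i c
      {sep : True (separate? {1} {4} ((ι 0F 0F , ω 0F , ω 1F) ∷ (ι 0F c , ω 2F , ω 3F) ∷ []))} →
      Big i → G (v i c) ≤ 4
    big-link i c {sep} big = cross-intersecting _ _ big λ a∈ b∈ c∈ d∈ E E′ u → <⇒≱ ≤-refl
      (exchange (i ∷ []) _ uniq₁ u (a∈ ∷ b∈ ∷ c∈ ∷ d∈ ∷ []) _ (toWitness sep) (E ∷ E′ ∷ []))

    module _ {i j} (i≢j : i ≢ j) (big : Big i) where

      -- The order of choice matters: first z for the second cell, then an edge {p , q} of the big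
      -- link avoiding z, and last y for the first cell. Only y must avoid three vertices, hence the
      -- bound 3.
      half : ∀ {a₁ a₂ b b₁ b₂} → (a₁ , a₂) ∈ rest 0F → (b₁ , b₂) ∈ rest b →
        0 < N (v i a₂) (v j b₂) → N (v i a₁) (v j b₁) ≤ 3
      half a∈ b∈ 0<N = ≮⇒≥ λ 3<N →
        let z , z∈ , E₂ , _ = pick _ _ [] 0<N
            p , q , p∈ , q∈ , E , z≢p , z≢q = pick-avoiding z big
            y , y∈ , E₁ , y∉ = pick _ _ (p ∷ q ∷ z ∷ []) 3<N
        in <⇒≱ ≤-refl (exchange (i ∷ j ∷ []) (p ∷ q ∷ y ∷ z ∷ []) (uniq₂ i≢j)
            ((link-distinct E ∷ (y∉ ∘ here ∘ sym) ∷ (z≢p ∘ sym) ∷ [])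
              ∷ ((y∉ ∘ there ∘ here ∘ sym) ∷ (z≢q ∘ sym) ∷ [])
              ∷ ((y∉ ∘ there ∘ there ∘ here) ∷ []) ∷ [] ∷ [])
            (p∈ ∷ q∈ ∷ y∈ ∷ z∈ ∷ []) (twoCells _ _)
            (All.lookup (All.lookup (All.lookup separate-twoCells a∈) (∈-cols _)) b∈) (E ∷ E₁ ∷ E₂ ∷ []))

      -- If both cells are nonempty, each is at most 3 by `half`, and 6 ≤ 3s. Otherwise one vanishes
      -- and the other obeys the codegree bound.
      two-cells : ∀ {a₁ a₂ b b₁ b₂} → (a₁ , a₂) ∈ rest 0F → (a₂ , a₁) ∈ rest 0F →
        (b₁ , b₂) ∈ rest b → (b₂ , b₁) ∈ rest b → N (v i a₁) (v j b₁) + N (v i a₂) (v j b₂) ≤ 3 * s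
      two-cells {a₁} {a₂} {b} {b₁} {b₂} a∈ a∈′ b∈ b∈′
        with 0 <? N (v i a₁) (v j b₁) | 0 <? N (v i a₂) (v j b₂)
      ... | no ¬p | _ rewrite n≤0⇒n≡0 (≮⇒≥ ¬p) = N≤3s _ _
      ... | yes _ | no ¬q rewrite n≤0⇒n≡0 (≮⇒≥ ¬q) | +-identityʳ (N (v i a₁) (v j b₁)) = N≤3s _ _
      ... | yes p | yes q =
        ≤-trans (+-mono-≤ (half a∈ b∈ q) (half a∈′ b∈′ p)) (≤-trans (m≤n+m 6 3) 9≤3s)

      -- The six cells of the 2 × 3 grid split into three pairs of disjoint cells.
      big-cells : ∑ (1F ∷ 2F ∷ []) (λ a → ∑ cols (λ b → N (v i a) (v j b))) ≤ 3 * (3 * s)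
      big-cells = begin
        w 1F 0F + (w 1F 1F + (w 1F 2F + 0)) + (w 2F 0F + (w 2F 1F + (w 2F 2F + 0)) + 0)
          ≡⟨ regroup (w 1F 0F) (w 1F 1F) (w 1F 2F) (w 2F 0F) (w 2F 1F) (w 2F 2F) ⟩
        (w 1F 0F + w 2F 1F) + ((w 1F 1F + w 2F 2F) + ((w 1F 2F + w 2F 0F) + 0))
          ≤⟨ +-mono-≤ (two-cells {b = 2F} f g f g) (+-mono-≤ (two-cells {b = 0F} f g f g)
               (+-monoˡ-≤ 0 (two-cells {b = 1F} f g g f))) ⟩
        3 * (3 * s) ∎
        where
        open ≤-Reasoning
        w : Fin 3 → Fin 3 → ℕ
        w a b = N (v i a) (v j b)
        f : ∀ {A : Set} {x : A} {xs} → x ∈ x ∷ xs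
        f = here refl
        g : ∀ {A : Set} {x y : A} {xs} → x ∈ y ∷ x ∷ xs
        g = there (here refl)
        regroup : ∀ a b c d e f → a + (b + (c + 0)) + (d + (e + (f + 0)) + 0)
          ≡ (a + e) + ((b + f) + ((c + d) + 0))
        regroup = solve-∀

    -- Greedy choice of three distinct vertices of `O`, starting from the cell that is only known to
    -- be nonempty.
    no-transversal : ∀ {i j} → i ≢ j → ∀ a b {a₁ a₂ b₁ b₂} → (a₁ , a₂) ∈ rest a → (b₁ , b₂) ∈ rest b →
      0 < N (v i a) (v j b) → 3 ≤ N (v i a₁) (v j b₁) → ¬ 3 ≤ N (v i a₂) (v j b₂)
    no-transversal {i} {j} i≢j a b a∈ b∈ 0<N 3≤N₁ 3≤N₂ =
      let x , x∈ , E , _ = pick _ _ [] 0<N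
          y , y∈ , E₁ , y∉ = pick _ _ (x ∷ []) (<-≤-trans (s<s z<s) 3≤N₁)
          z , z∈ , E₂ , z∉ = pick _ _ (x ∷ y ∷ []) 3≤N₂
      in <⇒≱ ≤-refl (exchange (i ∷ j ∷ []) (x ∷ y ∷ z ∷ []) (uniq₂ i≢j)
        (((y∉ ∘ here ∘ sym) ∷ (z∉ ∘ here ∘ sym) ∷ []) ∷ ((z∉ ∘ there ∘ here ∘ sym) ∷ []) ∷ [] ∷ [])
        (x∈ ∷ y∈ ∷ z∈ ∷ []) (transversal a _ b _)
        (All.lookup (All.lookup (All.lookup (All.lookup separate-transversal (∈-cols a)) a∈) (∈-cols b)) b∈)
        (E ∷ E₁ ∷ E₂ ∷ []))

    largeCells : Fin s → Fin s → Graph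
    largeCells i j = large (λ a b → N (v i a) (v j b))

    -- Greedily chosen vertices of `O` extend the three large cells to disjoint edges; with the
    -- triple itself, four edges would replace three.
    low-triple : ∀ {i j k} → i ≢ j → i ≢ k → j ≢ k → ∀ x →
      T (killed (largeCells i j) (largeCells i k) (largeCells j k) x) →
      ¬ Edge (v i (proj₁ x)) (v j (proj₁ (proj₂ x))) (v k (proj₂ (proj₂ x)))
    low-triple {i} {j} {k} i≢j i≢k j≢k (a , b , c) h E
      with (a₁ , a₂) , a∈ , h ← any-∃ {xs = rest a} h
      with (b₁ , b₂) , b∈ , h ← any-∃ {xs = rest b} h
      with h₁₂ , h ← Equivalence.to (T-∧ {at (largeCells i j) a₁ b₁}) h
      with (c₁ , c₂) , c∈ , h ← any-∃ {xs = rest c} h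
      with h₁₃ , h₂₃ ← Equivalence.to (T-∧ {at (largeCells i k) a₂ c₁}) h =
      let cell = λ i j a b → N (v i a) (v j b)
          x , x∈ , E₁ , _ = pick _ _ [] (<-≤-trans z<s (large⇒3≤ (cell i j) a₁ b₁ h₁₂))
          y , y∈ , E₂ , y∉ = pick _ _ (x ∷ []) (<-≤-trans (s<s z<s) (large⇒3≤ (cell i k) a₂ c₁ h₁₃))
          z , z∈ , E₃ , z∉ = pick _ _ (x ∷ y ∷ []) (large⇒3≤ (cell j k) b₂ c₂ h₂₃)
      in <⇒≱ ≤-refl (exchange (i ∷ j ∷ k ∷ []) (x ∷ y ∷ z ∷ [])
        ((i≢j ∷ i≢k ∷ []) ∷ (j≢k ∷ []) ∷ [] ∷ [])
        (((y∉ ∘ here ∘ sym) ∷ (z∉ ∘ here ∘ sym) ∷ []) ∷ ((z∉ ∘ there ∘ here ∘ sym) ∷ []) ∷ [] ∷ [])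
        (x∈ ∷ y∈ ∷ z∈ ∷ []) (tripleAndCells a _ b _ c _)
        (All.lookup (All.lookup (All.lookup (All.lookup (All.lookup (All.lookup separate-tripleAndCells
          (∈-cols a)) a∈) (∈-cols b)) b∈) (∈-cols c)) c∈)
        (E ∷ E₁ ∷ E₂ ∷ E₃ ∷ []))

  -- Amortised summation over the blocks.

  module Counting {n s : ℕ} (S : System n s) (3≤s : 3 ≤ s) where
    open System S
    open LocalBounds S 3≤s

    Block : Set
    Block = ∃[ i ] (Big i ⊎ Low i)

    -- The vertices of the i-th edge of the matching, except for one of large degree.
    B : Block → List (Fin n)
    B (i , inj₁ _) = map (v i) (1F ∷ 2F ∷ [])
    B (i , inj₂ _) = map (v i) cols

    open Blocks B O e

    -- κ x + κ y bounds the number of edges meeting x, y and O in one vertex each, up to a constant.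
    through κ : Block → ℕ
    through (i , inj₁ _) = 3 * s * (3 * s)
    through (i , inj₂ _) = 0
    κ (i , inj₁ _) = 0
    κ (i , inj₂ _) = 3 * (3 * s)

    -- The difference of `s * κ b` and `κ b` reserves the cost of `b` in its s - 1 pairs; for a low
    -- block this takes the place of the 9s² edges through a big vertex. The 8 is 4 + 4 from
    -- `big-link`; for a low block only 7 is used, 2 from each of three applications of `low-cell`
    -- and 1 for the edge of the matching.
    single-bound : ∀ b → through b + single b + s * κ b ≤ 3 * s * (3 * s) + 8 + κ b
    single-bound (i , inj₁ big) = begin
      3 * s * (3 * s) + ((N₁₂ + 0 + 0) + (G (v i 1F) + (G (v i 2F) + 0))) + s * 0
        ≤⟨ +-mono-≤ (+-monoʳ-≤ (3 * s * (3 * s)) (+-mono-≤ {x = N₁₂ + 0 + 0} {y = 0}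
             (≤-reflexive (cong (λ x → x + 0 + 0) (big-cell i big)))
             (+-mono-≤ (big-link i 1F big)
             (+-monoˡ-≤ 0 (big-link i 2F big)))))
             (≤-reflexive (*-zeroʳ s)) ⟩
      3 * s * (3 * s) + 8 + 0 ∎
      where
      open ≤-Reasoning
      N₁₂ = N (v i 1F) (v i 2F)
    single-bound (i , inj₂ low) = begin
      single (i , inj₂ low) + s * (3 * (3 * s))
        ≡⟨ regroup e₀₁₂ (N (x 0F) (x 1F)) (N (x 0F) (x 2F)) (N (x 1F) (x 2F))
             (G (x 0F)) (G (x 1F)) (G (x 2F)) s ⟩
      (N (x 0F) (x 1F) + G (x 2F)) + (N (x 0F) (x 2F) + G (x 1F)) + (N (x 1F) (x 2F) + G (x 0F))
        + e₀₁₂ + 9 * s * s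
        ≤⟨ +-monoˡ-≤ (9 * s * s) (+-mono-≤ (+-mono-≤ (+-mono-≤
             (low-cell i 0F 1F 2F low)
             (low-cell i 0F 2F 1F low))
             (low-cell i 1F 2F 0F low))
             (e≤1 (x 0F) (x 1F) (x 2F))) ⟩
      (2 + 3 * s) + (2 + 3 * s) + (2 + 3 * s) + 1 + 9 * s * s
        ≤⟨ n≤1+n _ ⟩
      1 + ((2 + 3 * s) + (2 + 3 * s) + (2 + 3 * s) + 1 + 9 * s * s)
        ≡⟨ collect s ⟩
      3 * s * (3 * s) + 8 + 3 * (3 * s) ∎
      where
      open ≤-Reasoning
      x : Fin 3 → Fin n
      x = v i
      e₀₁₂ = e (x 0F) (x 1F) (x 2F)
      regroup : ∀ e N₀₁ N₀₂ N₁₂ G₀ G₁ G₂ s →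
        e + 0 + 0 + 0 + (N₀₁ + (N₀₂ + 0) + (N₁₂ + 0 + 0)) + (G₀ + (G₁ + (G₂ + 0))) + s * (3 * (3 * s))
          ≡ (N₀₁ + G₂) + (N₀₂ + G₁) + (N₁₂ + G₀) + e + 9 * s * s
      regroup = solve-∀
      collect : ∀ s → 1 + ((2 + 3 * s) + (2 + 3 * s) + (2 + 3 * s) + 1 + 9 * s * s)
        ≡ 3 * s * (3 * s) + 8 + 3 * (3 * s)
      collect = solve-∀

    -- The right side evaluates to 18 for two blocks of three vertices and to 9 for blocks of three
    -- and two.
    inside-two-blocks : ∀ xs ys → ∑₂ xs (λ a b → ∑ ys (e a b)) + ∑ xs (λ a → ∑₂ ys (e a))
      ≤ ∑₂ xs (λ _ _ → ∑ ys (λ _ → 1)) + ∑ xs (λ _ → ∑₂ ys (λ _ _ → 1))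
    inside-two-blocks xs ys = +-mono-≤ (∑₂-mono xs λ a b → ∑-mono ys (e≤1 a b))
      (∑-mono xs λ a → ∑₂-mono ys (e≤1 a))

    -- The two big links contain disjoint edges, since otherwise `cross-intersecting` would leave at
    -- most 4 < 3s edges in the second one. Its hypothesis is a negation, so the bound is derived by
    -- contradiction. Given the disjoint edges, none of the four remaining vertices span an edge,
    -- and each of the four cells is completed only by the four endpoints.
    big-big : ∀ {i j} → i ≢ j → (big : Big i) (big′ : Big j) → pair (i , inj₁ big) (j , inj₁ big′) ≤ 16
    big-big {i} {j} i≢j big big′ = decidable-stable (_ ≤? 16) λ ≰16 →
      <⇒≱ (≤-<-trans (≤-trans (m≤n+m 4 5) 9≤3s) big′)
        (cross-intersecting (v i 0F) (v j 0F) big λ a∈ b∈ c∈ d∈ E E′ u →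
          ≰16 (bound u (a∈ ∷ b∈ ∷ c∈ ∷ d∈ ∷ []) E E′))
      where
      bound : ∀ {a b c d} → Unique (a ∷ b ∷ c ∷ d ∷ []) → All (_∈ O) (a ∷ b ∷ c ∷ d ∷ []) →
        Edge (v i 0F) a b → Edge (v j 0F) c d → pair (i , inj₁ big) (j , inj₁ big′) ≤ 16
      bound {a} {b} {c} {d} u os∈ E E′ =
        +-mono-≤ (+-mono-≤
          (+-mono-≤ (+-mono-≤ (+-mono-≤ (inside (ι 0F 1F) (ι 0F 2F) (ι 1F 1F))
            (+-mono-≤ (inside (ι 0F 1F) (ι 0F 2F) (ι 1F 2F)) 0≤0)) 0≤0) 0≤0)
          (+-mono-≤ (+-mono-≤ (+-mono-≤ (inside (ι 0F 1F) (ι 1F 1F) (ι 1F 2F)) 0≤0) 0≤0)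
            (+-mono-≤ (+-mono-≤ (+-mono-≤ (inside (ι 0F 2F) (ι 1F 1F) (ι 1F 2F)) 0≤0) 0≤0) 0≤0)))
          (+-mono-≤ (+-mono-≤ (cell 1F 1F) (+-mono-≤ (cell 1F 2F) 0≤0))
            (+-mono-≤ (+-mono-≤ (cell 2F 1F) (+-mono-≤ (cell 2F 2F) 0≤0)) 0≤0))
        where
        0≤0 : 0 ≤ 0
        0≤0 = z≤n
        P : Label 2 4 → Fin n
        P = vertex (i ∷ j ∷ []) (a ∷ b ∷ c ∷ d ∷ [])
        inside : ∀ x y z
          {sep : True (separate? ((ι 0F 0F , ω 0F , ω 1F) ∷ (ι 1F 0F , ω 2F , ω 3F) ∷ (x , y , z) ∷ []))} →
          e (P x) (P y) (P z) ≤ 0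
        inside x y z {sep} = ≤-reflexive (e≡0 λ E″ → <⇒≱ ≤-refl
          (exchange (i ∷ j ∷ []) (a ∷ b ∷ c ∷ d ∷ []) (uniq₂ i≢j) u os∈ _ (toWitness sep)
            (E ∷ E′ ∷ E″ ∷ [])))
        cell : ∀ x y {sep : True (separate? {2} {5}
            ((ι 0F 0F , ω 1F , ω 2F) ∷ (ι 1F 0F , ω 3F , ω 4F) ∷ (ι 0F x , ι 1F y , ω 0F) ∷ []))} →
          N (v i x) (v j y) ≤ 4
        cell x y {sep} = ∑-support O-unique (e≤1 _ _) λ {z} z∈ 0<e →
          decidable-stable (z ∈? a ∷ b ∷ c ∷ d ∷ []) λ z∉ → <⇒≱ ≤-refl
            (exchange (i ∷ j ∷ []) (z ∷ a ∷ b ∷ c ∷ d ∷ []) (uniq₂ i≢j) (∉-swap z∉ ∷ u) (z∈ ∷ os∈)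
              _ (toWitness sep) (E ∷ E′ ∷ e⇒Edge 0<e ∷ []))
          where open DecMembership (_≟_ {n}) using (_∈?_)

    -- `m` is the number of triples of blocks containing a given pair, and `c` is the codegree bound
    -- reduced by the 8 of `cells-bound`.
    module _ {m c} (s≡ : s ≡ 2 + m) (3s≡ : 3 * s ≡ 8 + c) where

      δ : Block → Block → ℕ
      δ (i , inj₂ _) (j , inj₂ _) = c * deficit (largeCells i j)
      δ _            _            = 0

      pair-bound : ∀ x y → proj₁ x ≢ proj₁ y → pair x y + δ x y ≤ κ x + κ y + 18
      pair-bound (i , inj₁ big) (j , inj₁ big′) i≢j =
        ≤-trans (≤-reflexive (+-identityʳ _)) (≤-trans (big-big i≢j big big′) (m≤m+n 16 2))
      pair-bound (i , inj₁ big) (j , inj₂ low) i≢j = begin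
        pair (i , inj₁ big) (j , inj₂ low) + 0
          ≡⟨ +-identityʳ _ ⟩
        pair (i , inj₁ big) (j , inj₂ low)
          ≤⟨ +-mono-≤ (inside-two-blocks (B (i , inj₁ big)) (B (j , inj₂ low))) (big-cells i≢j big) ⟩
        9 + 3 * (3 * s)
          ≤⟨ +-monoˡ-≤ (3 * (3 * s)) (m≤m+n 9 9) ⟩
        18 + 3 * (3 * s)
          ≡⟨ +-comm 18 (3 * (3 * s)) ⟩
        3 * (3 * s) + 18 ∎
        where open ≤-Reasoning
      pair-bound (i , inj₂ low) (j , inj₁ big) i≢j = begin
        pair (i , inj₂ low) (j , inj₁ big) + 0
          ≡⟨ +-identityʳ _ ⟩
        pair (i , inj₂ low) (j , inj₁ big)
          ≤⟨ +-mono-≤ (inside-two-blocks (B (i , inj₂ low)) (B (j , inj₁ big))) (begin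
               ∑ cols (λ b → ∑ (1F ∷ 2F ∷ []) (λ a → N (v i b) (v j a)))
                 ≡⟨ ∑-comm cols (1F ∷ 2F ∷ []) (λ b a → N (v i b) (v j a)) ⟩
               ∑ (1F ∷ 2F ∷ []) (λ a → ∑ cols (λ b → N (v i b) (v j a)))
                 ≡⟨ ∑-cong (1F ∷ 2F ∷ []) (λ a → ∑-cong cols (λ b → N-sym (v i b) (v j a))) ⟩
               ∑ (1F ∷ 2F ∷ []) (λ a → ∑ cols (λ b → N (v j a) (v i b)))
                 ≤⟨ big-cells (i≢j ∘ sym) big ⟩
               3 * (3 * s) ∎) ⟩
        9 + 3 * (3 * s)
          ≤⟨ +-monoˡ-≤ (3 * (3 * s)) (m≤m+n 9 9) ⟩
        18 + 3 * (3 * s)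
          ≡⟨ cong (18 +_) (+-identityʳ (3 * (3 * s))) ⟨
        18 + (3 * (3 * s) + 0)
          ≡⟨ +-comm 18 (3 * (3 * s) + 0) ⟩
        3 * (3 * s) + 0 + 18 ∎
        where open ≤-Reasoning
      pair-bound (i , inj₂ low) (j , inj₂ low′) i≢j = begin
        pair x y + c * deficit (largeCells i j)
          ≤⟨ +-monoˡ-≤ _ (+-monoˡ-≤ p (inside-two-blocks (B x) (B y))) ⟩
        18 + p + c * deficit (largeCells i j)
          ≡⟨ +-assoc 18 p _ ⟩
        18 + (p + c * deficit (largeCells i j))
          ≤⟨ +-monoʳ-≤ 18 (cells-bound (λ a b → N (v i a) (v j b)) (no-transversal i≢j)
               (λ a b → ≤-trans (N≤3s _ _) (≤-reflexive 3s≡))) ⟩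
        18 + 6 * (8 + c)
          ≡⟨ cong (λ t → 18 + 6 * t) 3s≡ ⟨
        18 + 6 * (3 * s)
          ≡⟨ collect (3 * s) ⟩
        3 * (3 * s) + 3 * (3 * s) + 18 ∎
        where
        open ≤-Reasoning
        x y : Block
        x = i , inj₂ low
        y = j , inj₂ low′
        p = ∑ cols (λ a → ∑ cols (λ b → N (v i a) (v j b)))
        collect : ∀ t → 18 + 6 * t ≡ 3 * t + 3 * t + 18
        collect = solve-∀

      -- For triples with a big block: such a block has two vertices left, so at most 2 · 3 · 3 = 18
      -- triples exist at all.
      few-triples : ∀ x y z d → ∑ (B x) (λ _ → ∑ (B y) (λ _ → ∑ (B z) (λ _ → 1))) ≤ 18 →
        m * triple x y z ≤ 18 * m + 6 + d
      few-triples x y z d ≤18 = begin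
        m * triple x y z    ≤⟨ *-monoʳ-≤ m (≤-trans
                                (∑-mono (B x) λ a → ∑-mono (B y) λ b → ∑-mono (B z) (e≤1 a b)) ≤18) ⟩
        m * 18              ≡⟨ *-comm m 18 ⟩
        18 * m              ≤⟨ m≤m+n _ 6 ⟩
        18 * m + 6          ≤⟨ m≤m+n _ d ⟩
        18 * m + 6 + d      ∎
        where open ≤-Reasoning

      triple-bound : ∀ x y z → proj₁ x ≢ proj₁ y → proj₁ x ≢ proj₁ z → proj₁ y ≢ proj₁ z →
        m * triple x y z ≤ 18 * m + 6 + (δ x y + δ x z + δ y z)
      triple-bound x@(_ , inj₁ _) y@(_ , inj₁ _) z@(_ , inj₁ _) _ _ _ = few-triples x y z _ (m≤m+n 8 10)
      triple-bound x@(_ , inj₁ _) y@(_ , inj₁ _) z@(_ , inj₂ _) _ _ _ = few-triples x y z _ (m≤m+n 12 6)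
      triple-bound x@(_ , inj₁ _) y@(_ , inj₂ _) z@(_ , inj₁ _) _ _ _ = few-triples x y z _ (m≤m+n 12 6)
      triple-bound x@(_ , inj₂ _) y@(_ , inj₁ _) z@(_ , inj₁ _) _ _ _ = few-triples x y z _ (m≤m+n 12 6)
      triple-bound x@(_ , inj₁ _) y@(_ , inj₂ _) z@(_ , inj₂ _) _ _ _ = few-triples x y z _ ≤-refl
      triple-bound x@(_ , inj₂ _) y@(_ , inj₁ _) z@(_ , inj₂ _) _ _ _ = few-triples x y z _ ≤-refl
      triple-bound x@(_ , inj₂ _) y@(_ , inj₂ _) z@(_ , inj₁ _) _ _ _ = few-triples x y z _ ≤-refl
      triple-bound (i , inj₂ low) (j , inj₂ low′) (k , inj₂ low″) i≢j i≢k j≢k = subst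
        (λ t → m * t ≤ 18 * m + 6 + (c * deficit (largeCells i j) + c * deficit (largeCells i k)
          + c * deficit (largeCells j k)))
        (trans (∑-cartesianProduct cols (cartesianProduct cols cols) t)
          (∑-cong cols λ a → ∑-cartesianProduct cols cols (λ bc → t (a , bc))))
        (triples-bound {m} {c} (largeCells i j) (largeCells i k) (largeCells j k) t 3m≡
          (large-PMfree _ (no-transversal i≢j)) (large-PMfree _ (no-transversal i≢k))
          (large-PMfree _ (no-transversal j≢k)) (λ _ → e≤1 _ _ _)
          (λ x h → e≡0 (low-triple i≢j i≢k j≢k x h)))
        where
        t : Fin 3 × Fin 3 × Fin 3 → ℕ
        t (a , b , c) = e (v i a) (v j b) (v k c)
        3m≡ : 3 * m ≡ 2 + c
        3m≡ = +-cancelˡ-≡ 6 _ _ (trans (sym (*-distribˡ-+ 3 2 m)) (trans (cong (3 *_) (sym s≡)) 3s≡))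

      module _ (bs : List Block) (distinct-blocks : Unique (map proj₁ bs)) (len : length bs ≡ s) where
        private
          U = 3 * s * (3 * s) + 8
          TS = ∑ bs through + ∑ bs single
          P = ∑₂ bs pair
          R = ∑₃ bs triple
          D = ∑₂ bs δ
          D₃ = ∑₃ bs (λ x y z → δ x y + δ x z + δ y z)
          K = ∑ bs κ
          K₂ = ∑₂ bs (λ x y → κ x + κ y)
          p = ∑₂ bs (λ _ _ → 1)
          t = ∑₃ bs (λ _ _ _ → 1)

        open ≤-Reasoning

        singles : TS + s * K ≤ s * U + K
        singles = begin
          TS + s * K
            ≡⟨ cong₂ _+_ (∑-+ bs through single) (∑-*ˡ bs s κ) ⟨
          ∑ bs (λ b → through b + single b) + ∑ bs (λ b → s * κ b)
            ≡⟨ ∑-+ bs _ _ ⟨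
          ∑ bs (λ b → through b + single b + s * κ b)
            ≤⟨ ∑-mono bs single-bound ⟩
          ∑ bs (λ b → U + κ b)
            ≡⟨ ∑-+ bs _ κ ⟩
          ∑ bs (λ _ → U) + K
            ≡⟨ cong (_+ K) (trans (∑-const bs U) (cong (_* U) len)) ⟩
          s * U + K ∎

        pairs : P + D ≤ K₂ + 18 * p
        pairs = begin
          P + D
            ≡⟨ ∑₂-+ bs pair δ ⟨
          ∑₂ bs (λ x y → pair x y + δ x y)
            ≤⟨ ∑₂-mono-≢ bs distinct-blocks (λ {x} {y} → pair-bound x y) ⟩
          ∑₂ bs (λ x y → κ x + κ y + 18)
            ≡⟨ ∑₂-+ bs _ _ ⟩
          K₂ + ∑₂ bs (λ _ _ → 18)
            ≡⟨ cong (K₂ +_) (∑₂-*ˡ bs 18 (λ _ _ → 1)) ⟩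
          K₂ + 18 * p ∎

        triples : m * R ≤ (18 * m + 6) * t + D₃
        triples = begin
          m * R
            ≡⟨ ∑₃-*ˡ bs m triple ⟨
          ∑₃ bs (λ x y z → m * triple x y z)
            ≤⟨ ∑₃-mono-≢ bs distinct-blocks (λ {x} {y} {z} → triple-bound x y z) ⟩
          ∑₃ bs (λ x y z → 18 * m + 6 + (δ x y + δ x z + δ y z))
            ≡⟨ ∑₃-+ bs _ _ ⟩
          ∑₃ bs (λ _ _ _ → 18 * m + 6) + D₃
            ≡⟨ cong (_+ D₃) (begin-equality
                 ∑₃ bs (λ _ _ _ → 18 * m + 6)
                   ≡⟨ cong (λ k → ∑₃ bs (λ _ _ _ → k)) (*-identityʳ (18 * m + 6)) ⟨
                 ∑₃ bs (λ _ _ _ → (18 * m + 6) * 1)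
                   ≡⟨ ∑₃-*ˡ bs (18 * m + 6) (λ _ _ _ → 1) ⟩
                 (18 * m + 6) * t ∎) ⟩
          (18 * m + 6) * t + D₃ ∎

        count-pairs : 2 * p + s ≡ s * s
        count-pairs = begin-equality
          2 * p + s                             ≡⟨ cong₂ _+_ (∑₂-*ˡ bs 2 (λ _ _ → 1)) (trans (∑-1 bs) len) ⟨
          ∑₂ bs (λ _ _ → 2) + ∑ bs (λ _ → 1)    ≡⟨ ∑₂-pairs (λ _ → 1) bs ⟩
          length bs * ∑ bs (λ _ → 1)            ≡⟨ cong₂ _*_ len (trans (∑-1 bs) len) ⟩
          s * s                                 ∎

        sum-over-triples : ∀ d → ∑₃ bs (λ x y z → d x y + d x z + d y z) ≡ m * ∑₂ bs d
        sum-over-triples d = +-cancelʳ-≡ (2 * ∑₂ bs d) _ _ (begin-equality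
          ∑₃ bs (λ x y z → d x y + d x z + d y z) + 2 * ∑₂ bs d  ≡⟨ ∑₃-pairs d bs ⟩
          length bs * ∑₂ bs d                                    ≡⟨ cong (_* ∑₂ bs d) (trans len s≡) ⟩
          (2 + m) * ∑₂ bs d                                      ≡⟨ *-distribʳ-+ (∑₂ bs d) 2 m ⟩
          2 * ∑₂ bs d + m * ∑₂ bs d                              ≡⟨ +-comm (2 * ∑₂ bs d) _ ⟩
          m * ∑₂ bs d + 2 * ∑₂ bs d                              ∎)

        count-triples : 3 * t ≡ m * p
        count-triples = trans (sym (∑₃-*ˡ bs 3 (λ _ _ _ → 1))) (sum-over-triples (λ _ _ → 1))

        -- By `∑₂-pairs`, the κ of all pairs and the one `K` from `singles` add up to `s * K`, the
        -- amount reserved there.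
        singles-and-pairs : TS + P + D ≤ s * U + 18 * p
        singles-and-pairs = +-cancelʳ-≤ (s * K) _ _ (begin
          TS + P + D + s * K               ≡⟨ regroup TS P D (s * K) ⟩
          (TS + s * K) + (P + D)           ≤⟨ +-mono-≤ singles pairs ⟩
          (s * U + K) + (K₂ + 18 * p)      ≡⟨ regroup′ (s * U) K K₂ (18 * p) ⟩
          s * U + 18 * p + (K₂ + K)        ≡⟨ cong (s * U + 18 * p +_)
                                               (trans (∑₂-pairs κ bs) (cong (_* K) len)) ⟩
          s * U + 18 * p + s * K           ∎)
          where
          regroup : ∀ a b c d → a + b + c + d ≡ (a + d) + (b + c)
          regroup = solve-∀
          regroup′ : ∀ a b c d → (a + b) + (c + d) ≡ a + d + (c + b)
          regroup′ = solve-∀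

        -- Scaling by `m` is what makes the savings cancel: summed over the triples, δ becomes
        -- `m * D`. The 6 per triple turns into 2 per pair, as 6t = 2mp.
        scaled : m * (TS + P + R) ≤ m * (s * U + 18 * p + 18 * t + 2 * p)
        scaled = +-cancelʳ-≤ (m * D) _ _ (begin
          m * (TS + P + R) + m * D
            ≡⟨ regroup m TS P R D ⟩
          m * (TS + P + D) + m * R
            ≤⟨ +-mono-≤ (*-monoʳ-≤ m singles-and-pairs) triples ⟩
          m * (s * U + 18 * p) + ((18 * m + 6) * t + D₃)
            ≡⟨ cong (λ d → m * (s * U + 18 * p) + ((18 * m + 6) * t + d)) (sum-over-triples δ) ⟩
          m * (s * U + 18 * p) + ((18 * m + 6) * t + m * D)
            ≡⟨ regroup′ m (s * U + 18 * p) t (m * D) ⟩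
          m * (s * U + 18 * p + 18 * t) + 2 * (3 * t) + m * D
            ≡⟨ cong (λ x → m * (s * U + 18 * p + 18 * t) + 2 * x + m * D) count-triples ⟩
          m * (s * U + 18 * p + 18 * t) + 2 * (m * p) + m * D
            ≡⟨ cong (_+ m * D) (factor m (s * U + 18 * p + 18 * t) p) ⟩
          m * (s * U + 18 * p + 18 * t + 2 * p) + m * D ∎)
          where
          regroup : ∀ m a b c d → m * (a + b + c) + m * d ≡ m * (a + b + d) + m * c
          regroup = solve-∀
          regroup′ : ∀ m a t d → m * a + ((18 * m + 6) * t + d) ≡ m * (a + 18 * t) + 2 * (3 * t) + d
          regroup′ = solve-∀
          factor : ∀ m a p → m * a + 2 * (m * p) ≡ m * (a + 2 * p)
          factor = solve-∀

        -- With p = s(s - 1)/2 and t = (s - 2)p/3, the bound 9s³ + 8s + 20p + 18t is the stated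
        -- polynomial; the counts are substituted as multiples 2p and 3t to avoid division.
        blocks-bound : 0 < m → TS + P + R ≤ 12 * (s * s * s) + s * s + 4 * s
        blocks-bound 0<m = ≤-trans (*-cancelˡ-≤ m {{>-nonZero 0<m}} scaled) (≤-reflexive total)
          where
          2p≡ : 2 * p ≡ (2 + m) * (1 + m)
          2p≡ = +-cancelʳ-≡ s _ _ (trans count-pairs (trans (cong₂ _*_ s≡ s≡)
            (trans (expand m) (cong ((2 + m) * (1 + m) +_) (sym s≡)))))
            where
            expand : ∀ m → (2 + m) * (2 + m) ≡ (2 + m) * (1 + m) + (2 + m)
            expand = solve-∀
          total : s * U + 18 * p + 18 * t + 2 * p ≡ 12 * (s * s * s) + s * s + 4 * s
          total = begin-equality
            s * U + 18 * p + 18 * t + 2 * p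
              ≡⟨ regroup s p t ⟩
            s * (3 * s * (3 * s) + 8) + 20 * p + 6 * (3 * t)
              ≡⟨ cong (λ x → s * (3 * s * (3 * s) + 8) + 20 * p + 6 * x) count-triples ⟩
            s * (3 * s * (3 * s) + 8) + 20 * p + 6 * (m * p)
              ≡⟨ regroup′ s p m ⟩
            s * (3 * s * (3 * s) + 8) + (10 + 3 * m) * (2 * p)
              ≡⟨ cong (λ x → s * (3 * s * (3 * s) + 8) + (10 + 3 * m) * x) 2p≡ ⟩
            s * (3 * s * (3 * s) + 8) + (10 + 3 * m) * ((2 + m) * (1 + m))
              ≡⟨ cong (λ x → x * (3 * x * (3 * x) + 8) + (10 + 3 * m) * ((2 + m) * (1 + m))) s≡ ⟩
            (2 + m) * (3 * (2 + m) * (3 * (2 + m)) + 8) + (10 + 3 * m) * ((2 + m) * (1 + m))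
              ≡⟨ expand m ⟩
            12 * ((2 + m) * (2 + m) * (2 + m)) + (2 + m) * (2 + m) + 4 * (2 + m)
              ≡⟨ cong (λ x → 12 * (x * x * x) + x * x + 4 * x) s≡ ⟨
            12 * (s * s * s) + s * s + 4 * s ∎
            where
            regroup : ∀ s p t → s * (3 * s * (3 * s) + 8) + 18 * p + 18 * t + 2 * p
              ≡ s * (3 * s * (3 * s) + 8) + 20 * p + 6 * (3 * t)
            regroup = solve-∀
            regroup′ : ∀ s p m → s * (3 * s * (3 * s) + 8) + 20 * p + 6 * (m * p)
              ≡ s * (3 * s * (3 * s) + 8) + (10 + 3 * m) * (2 * p)
            regroup′ = solve-∀
            expand : ∀ m → (2 + m) * (3 * (2 + m) * (3 * (2 + m)) + 8) + (10 + 3 * m) * ((2 + m) * (1 + m))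
              ≡ 12 * ((2 + m) * (2 + m) * (2 + m)) + (2 + m) * (2 + m) + 4 * (2 + m)
            expand = solve-∀

-- From sets to triples of vertices.

module KGraphs where
  open import Defs
  open Sums
  open BipartiteGraphs
  open TripleSystems
  import Data.Bool.Properties as Bool
  open import Data.Fin using (Fin; zero; suc; _≟_)
  open import Data.Fin.Patterns using (0F; 1F; 2F)
  open import Data.Fin.Properties using (suc-injective) renaming (any? to any-fin?)
  open import Data.Fin.Subset as Subset using (Subset; inside; outside; ∣_∣; ⁅_⁆; _∪_)
  open import Data.Fin.Subset.Properties as Subset using ()
  open import Data.Nat using (ℕ; zero; suc; _+_; _*_; _∸_; _≤_; _<_; z≤n; s≤s; _<?_)
  open import Data.Nat.Tactic.RingSolver using (solve-∀)
  open import Data.Nat.Properties hiding (_≟_; suc-injective)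
  open import Data.List
    using (List; []; _∷_; _++_; map; filter; concatMap; length; allFin; lookup)
  open import Data.List.Properties using (length-++; length-map; map-∘; map-id; length-tabulate)
  open import Data.List.Membership.Propositional using (_∈_; find; lose)
  open import Data.List.Membership.Propositional.Properties
    using (∈-filter⁺; ∈-filter⁻; ∈-map⁺; ∈-map⁻; ∈-allFin; ∈-lookup; ∈-++⁺ˡ; ∈-++⁺ʳ;
      ∈-concatMap⁺; ∈-concatMap⁻)
  import Data.List.Membership.DecPropositional as DecMembership
  open import Data.List.Relation.Binary.Sublist.Propositional using (_⊆_)
  import Data.List.Relation.Binary.Sublist.Propositional as Sublist
  open import Data.List.Relation.Binary.Sublist.Propositional.Properties using (filter-⊆)
  open import Data.List.Relation.Unary.All as All using (All; []; _∷_)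
  import Data.List.Relation.Unary.All.Properties as All
  open import Data.List.Relation.Unary.AllPairs using (AllPairs; []; _∷_)
  open import Data.List.Relation.Unary.Any as Any using (Any; here; there; any?)
  open import Data.List.Relation.Unary.Unique.Propositional using (Unique)
  import Data.List.Relation.Unary.Any.Properties as Any
  import Data.List.Relation.Unary.Unique.Propositional.Properties as Unique
  open import Data.Product using (_×_; _,_; proj₁; proj₂; ∃-syntax)
  open import Data.Sum using (_⊎_; inj₁; inj₂; [_,_]′)
  open import Data.Vec using ([]; _∷_; here; there)
  import Data.Vec.Properties as Vec
  open import Function using (_∘_; id)
  open import Relation.Binary.Definitions using (DecidableEquality)
  open import Relation.Binary.PropositionalEquality
  open import Relation.Nullary using (Dec; yes; no; ¬_; contradiction; ¬?)

  private
    variable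
      A : Set
      n : ℕ

  elements : Subset n → List (Fin n)
  elements []            = []
  elements (inside ∷ p)  = zero ∷ map suc (elements p)
  elements (outside ∷ p) = map suc (elements p)

  length-elements : (p : Subset n) → length (elements p) ≡ ∣ p ∣
  length-elements []            = refl
  length-elements (inside ∷ p)  = cong suc (trans (length-map suc (elements p)) (length-elements p))
  length-elements (outside ∷ p) = trans (length-map suc (elements p)) (length-elements p)

  ∈-elements⁺ : ∀ {x} {p : Subset n} → x Subset.∈ p → x ∈ elements p
  ∈-elements⁺ {p = inside ∷ p}  here      = here refl
  ∈-elements⁺ {p = inside ∷ p}  (there q) = there (∈-map⁺ suc (∈-elements⁺ q))
  ∈-elements⁺ {p = outside ∷ p} (there q) = ∈-map⁺ suc (∈-elements⁺ q)

  ∈-elements⁻ : ∀ {x} (p : Subset n) → x ∈ elements p → x Subset.∈ p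
  ∈-elements⁻ (inside ∷ p)  (here refl) = here
  ∈-elements⁻ (inside ∷ p)  (there q) with _ , q′ , refl ← ∈-map⁻ suc q = there (∈-elements⁻ p q′)
  ∈-elements⁻ (outside ∷ p) q         with _ , q′ , refl ← ∈-map⁻ suc q = there (∈-elements⁻ p q′)

  elements-unique : (p : Subset n) → Unique (elements p)
  elements-unique []            = []
  elements-unique (inside ∷ p)  =
    All.tabulate (λ { q refl → contradiction (∈-map⁻ suc q) λ () })
      ∷ Unique.map⁺ suc-injective (elements-unique p)
  elements-unique (outside ∷ p) = Unique.map⁺ suc-injective (elements-unique p)

  ∣p∣≤length : (p : Subset n) {D : List (Fin n)} → (∀ {x} → x Subset.∈ p → x ∈ D) → ∣ p ∣ ≤ length D
  ∣p∣≤length p p⊆D = subst (_≤ _) (length-elements p)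
    (length-⊆ (elements-unique p) (p⊆D ∘ ∈-elements⁻ p))

  ∣⁅x⁆∪⁅y⁆∣≤2 : (x y : Fin n) → ∣ ⁅ x ⁆ ∪ ⁅ y ⁆ ∣ ≤ 2
  ∣⁅x⁆∪⁅y⁆∣≤2 x y = ∣p∣≤length (⁅ x ⁆ ∪ ⁅ y ⁆) {x ∷ y ∷ []} λ w∈ →
    [ (λ p → here (Subset.x∈⁅y⁆⇒x≡y x p)) , (λ p → there (here (Subset.x∈⁅y⁆⇒x≡y y p))) ]′
      (Subset.x∈p∪q⁻ ⁅ x ⁆ ⁅ y ⁆ w∈)

  ⟦_,_,_⟧ : Fin n → Fin n → Fin n → Subset n
  ⟦ x , y , z ⟧ = ⁅ x ⁆ ∪ (⁅ y ⁆ ∪ ⁅ z ⁆)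

  ∈-⟦⟧⁻ : ∀ {w} (x y z : Fin n) → w Subset.∈ ⟦ x , y , z ⟧ → w ∈ x ∷ y ∷ z ∷ []
  ∈-⟦⟧⁻ x y z w∈ with Subset.x∈p∪q⁻ ⁅ x ⁆ _ w∈
  ... | inj₁ p = here (Subset.x∈⁅y⁆⇒x≡y x p)
  ... | inj₂ q with Subset.x∈p∪q⁻ ⁅ y ⁆ ⁅ z ⁆ q
  ...   | inj₁ p = there (here (Subset.x∈⁅y⁆⇒x≡y y p))
  ...   | inj₂ r = there (there (here (Subset.x∈⁅y⁆⇒x≡y z r)))

  ∈-⟦⟧⁺ : ∀ {w} {x y z : Fin n} → w ∈ x ∷ y ∷ z ∷ [] → w Subset.∈ ⟦ x , y , z ⟧
  ∈-⟦⟧⁺ {x = x} (here refl)                 = Subset.x∈p∪q⁺ (inj₁ (Subset.x∈⁅x⁆ x))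
  ∈-⟦⟧⁺ {y = y} (there (here refl))         = Subset.x∈p∪q⁺ (inj₂ (Subset.x∈p∪q⁺ (inj₁ (Subset.x∈⁅x⁆ y))))
  ∈-⟦⟧⁺ {z = z} (there (there (here refl))) = Subset.x∈p∪q⁺ (inj₂ (Subset.x∈p∪q⁺ (inj₂ (Subset.x∈⁅x⁆ z))))

  ⟦⟧-swap₁₂ : (x y z : Fin n) → ⟦ x , y , z ⟧ ≡ ⟦ y , x , z ⟧
  ⟦⟧-swap₁₂ {n} x y z = trans (sym (Subset.∪-assoc ⁅ x ⁆ ⁅ y ⁆ ⁅ z ⁆))
    (trans (cong (_∪ ⁅ z ⁆) (Subset.∪-comm ⁅ x ⁆ ⁅ y ⁆)) (Subset.∪-assoc ⁅ y ⁆ ⁅ x ⁆ ⁅ z ⁆))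

  ⟦⟧-swap₂₃ : (x y z : Fin n) → ⟦ x , y , z ⟧ ≡ ⟦ x , z , y ⟧
  ⟦⟧-swap₂₃ {n} x y z = cong (⁅ x ⁆ ∪_) (Subset.∪-comm ⁅ y ⁆ ⁅ z ⁆)

  three : {xs : List A} → length xs ≡ 3 → ∃[ t ] xs ≡ verts t
  three {xs = x ∷ y ∷ z ∷ []} refl = (x , y , z) , refl

  3-set : (p : Subset n) → ∣ p ∣ ≡ 3 → ∃[ t ] elements p ≡ verts t
  3-set p ∣p∣≡3 = three (trans (length-elements p) ∣p∣≡3)

  ⟦⟧-elements : (p : Subset n) {x y z : Fin n} → elements p ≡ x ∷ y ∷ z ∷ [] → p ≡ ⟦ x , y , z ⟧
  ⟦⟧-elements p {x} {y} {z} eq = Subset.⊆-antisym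
    (λ q → ∈-⟦⟧⁺ (subst (_ ∈_) eq (∈-elements⁺ q)))
    (λ q → ∈-elements⁻ p (subst (_ ∈_) (sym eq) (∈-⟦⟧⁻ x y z q)))

  AllPairs-lookup : {R : A → A → Set} {xs : List A} → (∀ {x y} → R x y → R y x) → AllPairs R xs →
    ∀ {x y} → x ∈ xs → y ∈ xs → x ≢ y → R x y
  AllPairs-lookup R-sym (r ∷ rs) (here refl) (here refl) x≢y = contradiction refl x≢y
  AllPairs-lookup R-sym (r ∷ rs) (here refl) (there q)   x≢y = All.lookup r q
  AllPairs-lookup R-sym (r ∷ rs) (there p)   (here refl) x≢y = R-sym (All.lookup r p)
  AllPairs-lookup R-sym (r ∷ rs) (there p)   (there q)   x≢y = AllPairs-lookup R-sym rs p q x≢y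

  AllPairs-tabulate : {R : A → A → Set} {xs : List A} → Unique xs →
    (∀ {x y} → x ∈ xs → y ∈ xs → x ≢ y → R x y) → AllPairs R xs
  AllPairs-tabulate []       r = []
  AllPairs-tabulate (x∉ ∷ u) r =
    All.tabulate (λ y∈ → r (here refl) (there y∈) (All.lookup x∉ y∈))
      ∷ AllPairs-tabulate u (λ p q → r (there p) (there q))

  disjoint-sym : {p q : Subset n} → Disjoint p q → Disjoint q p
  disjoint-sym {p = p} {q} d (x , x∈) with x∈q , x∈p ← Subset.x∈p∩q⁻ q p x∈ =
    d (x , Subset.x∈p∩q⁺ (x∈p , x∈q))

  disjoint-∉ : ∀ {x} {p q : Subset n} → Disjoint p q → x Subset.∈ p → ¬ x Subset.∈ q
  disjoint-∉ d x∈p x∈q = d (_ , Subset.x∈p∩q⁺ (x∈p , x∈q))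

  _≟ˢ_ : DecidableEquality (Subset n)
  _≟ˢ_ = Vec.≡-dec Bool._≟_

  -- The number of edges of a whole system.

  module Bound {n s : ℕ} (S : System n s)
    (degree : ∀ x → ∑₂ (allFin n) (Local.e S x) ≤ 3 * s * (3 * s))
    (no-edge-outside : ∀ {x y z} → x ∈ System.O S → y ∈ System.O S → z ∈ System.O S →
      ¬ System.Edge S x y z)
    (located : ∀ x → (∃[ i ] ∃[ c ] System.v S i c ≡ x) ⊎ x ∈ System.O S) where

    open System S
    open Local S

    outside-empty : ∑₃ O e ≡ 0
    outside-empty = go O id
      where
      go₂ : ∀ {x} → x ∈ O → ∀ ys → (∀ {y} → y ∈ ys → y ∈ O) → ∑₂ ys (e x) ≡ 0
      go₂ x∈ []       ys⊆ = refl
      go₂ x∈ (y ∷ ys) ys⊆ = cong₂ _+_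
        (∑-zero ys (λ z∈ → e≡0 (no-edge-outside x∈ (ys⊆ (here refl)) (ys⊆ (there z∈)))))
        (go₂ x∈ ys (ys⊆ ∘ there))
      go : ∀ xs → (∀ {x} → x ∈ xs → x ∈ O) → ∑₃ xs e ≡ 0
      go []       xs⊆ = refl
      go (x ∷ xs) xs⊆ = cong₂ _+_ (go₂ (xs⊆ (here refl)) xs (xs⊆ ∘ there)) (go xs (xs⊆ ∘ there))

    -- The sums count positions in a list, while the size of a graph counts sets. `edges₁`, `edges₂`
    -- and `edges₃` mediate: their lengths are the sums, their entries the sets.
    edges₁ : Fin n → Fin n → List (Fin n) → List (Subset n)
    edges₁ x y L = map ⟦ x , y ,_⟧ (filter (edge? x y) L)

    edges₂ : Fin n → List (Fin n) → List (Subset n)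
    edges₂ x []      = []
    edges₂ x (y ∷ L) = edges₁ x y L ++ edges₂ x L

    edges₃ : List (Fin n) → List (Subset n)
    edges₃ []      = []
    edges₃ (x ∷ L) = edges₂ x L ++ edges₃ L

    length-edges₁ : ∀ x y L → length (edges₁ x y L) ≡ ∑ L (e x y)
    length-edges₁ x y []      = refl
    length-edges₁ x y (z ∷ L) with edge? x y z
    ... | yes _ = cong suc (length-edges₁ x y L)
    ... | no  _ = length-edges₁ x y L

    length-edges₂ : ∀ x L → length (edges₂ x L) ≡ ∑₂ L (e x)
    length-edges₂ x []      = refl
    length-edges₂ x (y ∷ L) =
      trans (length-++ (edges₁ x y L)) (cong₂ _+_ (length-edges₁ x y L) (length-edges₂ x L))

    length-edges₃ : ∀ L → length (edges₃ L) ≡ ∑₃ L e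
    length-edges₃ []      = refl
    length-edges₃ (x ∷ L) =
      trans (length-++ (edges₂ x L)) (cong₂ _+_ (length-edges₂ x L) (length-edges₃ L))

    ∈-edges₁ : ∀ {x y z L} → z ∈ L → Edge x y z → ⟦ x , y , z ⟧ ∈ edges₁ x y L
    ∈-edges₁ {x} {y} z∈ E = ∈-map⁺ ⟦ x , y ,_⟧ (∈-filter⁺ (edge? x y) z∈ E)

    ∈-edges₂ : ∀ {x y z} L → y ∈ L → z ∈ L → Edge x y z → ⟦ x , y , z ⟧ ∈ edges₂ x L
    ∈-edges₂ (w ∷ L) (here refl) (here refl) E = contradiction refl (link-distinct E)
    ∈-edges₂ (w ∷ L) (here refl) (there q)   E = ∈-++⁺ˡ (∈-edges₁ q E)
    ∈-edges₂ {x} {y} (w ∷ L) (there p) (here refl) E = subst (_∈ edges₂ x (w ∷ L))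
      (⟦⟧-swap₂₃ x w y) (∈-++⁺ˡ (∈-edges₁ p (swap₂₃ E)))
    ∈-edges₂ {x} (w ∷ L) (there p) (there q) E = ∈-++⁺ʳ (edges₁ x w L) (∈-edges₂ L p q E)

    ∈-edges₃ : ∀ {x y z} L → x ∈ L → y ∈ L → z ∈ L → Edge x y z → ⟦ x , y , z ⟧ ∈ edges₃ L
    ∈-edges₃ (w ∷ L) (here refl) (here refl) _           E = contradiction refl (distinct E)
    ∈-edges₃ (w ∷ L) (here refl) (there q)   (here refl) E = contradiction refl (distinct (swap₂₃ E))
    ∈-edges₃ (w ∷ L) (there p)   (here refl) (here refl) E = contradiction refl (link-distinct E)
    ∈-edges₃ (w ∷ L) (here refl) (there q)   (there r)   E = ∈-++⁺ˡ (∈-edges₂ L q r E)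
    ∈-edges₃ {x} {y} {z} (w ∷ L) (there p) (here refl) (there r) E = subst (_∈ edges₃ (w ∷ L))
      (⟦⟧-swap₁₂ w x z) (∈-++⁺ˡ (∈-edges₂ L p r (swap₁₂ E)))
    ∈-edges₃ {x} {y} {z} (w ∷ L) (there p) (there q) (here refl) E = subst (_∈ edges₃ (w ∷ L))
      (trans (⟦⟧-swap₁₂ w x y) (⟦⟧-swap₂₃ x w y)) (∈-++⁺ˡ (∈-edges₂ L p q (swap₁₂ (swap₂₃ E))))
    ∈-edges₃ (w ∷ L) (there p)   (there q)   (there r)   E = ∈-++⁺ʳ (edges₂ w L) (∈-edges₃ L p q r E)

    Large : Fin (s) → Set
    Large i = (∃[ c ] 3 * s < G (v i c)) ⊎ (∀ c → G (v i c) ≤ 3 * s)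

    large? : ∀ i → Large i
    large? i with any-fin? (λ c → 3 * s <? G (v i c))
    ... | yes p = inj₁ p
    ... | no ¬p = inj₂ λ c → ≮⇒≥ λ lt → ¬p (c , lt)

    -- The transposition of 0 and the first argument.
    swap₀ : Fin 3 → Fin 3 → Fin 3
    swap₀ 0F c  = c
    swap₀ 1F 0F = 1F
    swap₀ 1F 1F = 0F
    swap₀ 1F 2F = 2F
    swap₀ 2F 0F = 2F
    swap₀ 2F 1F = 1F
    swap₀ 2F 2F = 0F

    swap₀-involutive : ∀ a c → swap₀ a (swap₀ a c) ≡ c
    swap₀-involutive 0F c  = refl
    swap₀-involutive 1F 0F = refl
    swap₀-involutive 1F 1F = refl
    swap₀-involutive 1F 2F = refl
    swap₀-involutive 2F 0F = refl
    swap₀-involutive 2F 1F = refl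
    swap₀-involutive 2F 2F = refl

    swap₀-0 : ∀ a → swap₀ a 0F ≡ a
    swap₀-0 0F = refl
    swap₀-0 1F = refl
    swap₀-0 2F = refl

    first : ∀ {i} → Large i → Fin 3
    first (inj₁ (c , _)) = c
    -- Without a vertex of large degree nothing is renumbered.
    first (inj₂ _)       = 0F

    v′ : Fin (s) → Fin 3 → Fin n
    v′ i c = v i (swap₀ (first (large? i)) c)

    relabelled : System n (s)
    relabelled = record S
      { v         = v′
      ; v-inj     = λ {i} {j} eq → inj i j eq
      ; v-edge    = λ i → edge (first (large? i)) (v-edge i)
      ; O-outside = O-outside
      }
      where
      inj : ∀ i j {a b} → v′ i a ≡ v′ j b → (i , a) ≡ (j , b)
      inj i j {a} {b} eq with v-inj eq
      ... | p with refl ← cong proj₁ p = cong (i ,_)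
        (trans (sym (swap₀-involutive c a)) (trans (cong (swap₀ c) (cong proj₂ p)) (swap₀-involutive c b)))
        where c = first (large? i)
      edge : ∀ {i} c → Edge (v i 0F) (v i 1F) (v i 2F) →
        Edge (v i (swap₀ c 0F)) (v i (swap₀ c 1F)) (v i (swap₀ c 2F))
      edge 0F E = E
      edge 1F E = swap₁₂ E
      edge 2F E = swap₁₂ (swap₂₃ (swap₁₂ E))

    located′ : ∀ x → (∃[ i ] ∃[ c ] v′ i c ≡ x) ⊎ x ∈ O
    located′ x with located x
    ... | inj₁ (i , c , refl) =
      inj₁ (i , swap₀ (first (large? i)) c , cong (v i) (swap₀-involutive (first (large? i)) c))
    ... | inj₂ x∈ = inj₂ x∈

    module _ (3≤s : 3 ≤ s) where
      open LocalBounds relabelled 3≤s using (Big; Low)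
      open Counting relabelled 3≤s
      open Blocks B O e

      status : ∀ i → Big i ⊎ Low i
      -- The decision is generalised to a variable because `v′` is itself defined through
      -- `large? i`.
      status i = go (large? i)
        where
        go : (l : Large i) →
          3 * s < G (v i (swap₀ (first l) 0F)) ⊎ (∀ c → G (v i (swap₀ (first l) c)) ≤ 3 * s)
        go (inj₁ (c , big)) = inj₁ (subst (λ c → 3 * s < G (v i c)) (sym (swap₀-0 c)) big)
        go (inj₂ low)       = inj₂ λ c → low c

      blocks : List Block
      blocks = map (λ i → i , status i) (allFin (s))

      length-blocks : length blocks ≡ s
      length-blocks = trans (length-map _ (allFin (s))) (length-tabulate {n = s} id)

      blocks-distinct : Unique (map proj₁ blocks)
      blocks-distinct = subst Unique (sym (trans (sym (map-∘ (allFin (s)))) (map-id (allFin (s)))))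
        (Unique.allFin⁺ (s))

      bigVertices : Block → List (Fin n)
      bigVertices (i , inj₁ _) = v′ i 0F ∷ []
      bigVertices (i , inj₂ _) = []

      covered : ∀ x → x ∈ concatMap bigVertices blocks ⊎ x ∈ concatMap B blocks ++ O
      covered x with located′ x
      ... | inj₂ x∈ = inj₂ (∈-++⁺ʳ _ x∈)
      ... | inj₁ (i , c , refl) with status i | ∈-map⁺ (λ i → i , status i) (∈-allFin i)
      ...   | inj₂ low | b∈ =
        inj₂ (∈-++⁺ˡ (∈-concatMap⁺ B (lose b∈ (∈-map⁺ (v′ i) (∈-cols c)))))
      ...   | inj₁ big | b∈ with c
      ...     | 0F = inj₁ (∈-concatMap⁺ bigVertices (lose b∈ (here refl)))
      ...     | 1F = inj₂ (∈-++⁺ˡ (∈-concatMap⁺ B (lose b∈ (here refl))))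
      ...     | 2F = inj₂ (∈-++⁺ˡ (∈-concatMap⁺ B (lose b∈ (there (here refl)))))

      -- Edges with several big vertices are listed repeatedly, which is harmless for an upper
      -- bound.
      throughBig : List (Subset n)
      throughBig = concatMap (λ x → edges₂ x (allFin n)) (concatMap bigVertices blocks)

      ∈-throughBig : ∀ {x y z} → x ∈ concatMap bigVertices blocks → Edge x y z →
        ⟦ x , y , z ⟧ ∈ throughBig
      ∈-throughBig {x} x∈ E = ∈-concatMap⁺ (λ x → edges₂ x (allFin n))
        (lose x∈ (∈-edges₂ (allFin n) (∈-allFin _) (∈-allFin _) E))

      length-throughBig : length throughBig ≤ ∑ blocks through
      length-throughBig = begin
        length throughBig
          ≡⟨ ∑-1 throughBig ⟨
        ∑ throughBig (λ _ → 1)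
          ≡⟨ ∑-concatMap (λ x → edges₂ x (allFin n)) (concatMap bigVertices blocks) (λ _ → 1) ⟩
        ∑ (concatMap bigVertices blocks) (λ x → ∑ (edges₂ x (allFin n)) (λ _ → 1))
          ≡⟨ ∑-concatMap bigVertices blocks _ ⟩
        ∑ blocks (λ b → ∑ (bigVertices b) (λ x → ∑ (edges₂ x (allFin n)) (λ _ → 1)))
          ≤⟨ ∑-mono blocks bound ⟩
        ∑ blocks through ∎
        where
        open ≤-Reasoning
        bound : ∀ b → ∑ (bigVertices b) (λ x → ∑ (edges₂ x (allFin n)) (λ _ → 1)) ≤ through b
        bound (i , inj₁ _) = begin
          ∑ (edges₂ (v′ i 0F) (allFin n)) (λ _ → 1) + 0   ≡⟨ +-identityʳ _ ⟩
          ∑ (edges₂ (v′ i 0F) (allFin n)) (λ _ → 1)       ≡⟨ ∑-1 (edges₂ (v′ i 0F) (allFin n)) ⟩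
          length (edges₂ (v′ i 0F) (allFin n))            ≡⟨ length-edges₂ (v′ i 0F) (allFin n) ⟩
          ∑₂ (allFin n) (e (v′ i 0F))                     ≤⟨ degree (v′ i 0F) ⟩
          3 * s * (3 * s)                             ∎
        bound (i , inj₂ _) = z≤n

      module _ (Es : List (Subset n)) (Es-unique : Unique Es)
        (Es-edges : ∀ {p} → p ∈ Es → ∃[ x ] ∃[ y ] ∃[ z ] (p ≡ ⟦ x , y , z ⟧ × Edge x y z)) where

        length≤sums : length Es ≤ ∑ blocks through + ∑₃ (concatMap B blocks ++ O) e
        length≤sums = begin
          length Es
            ≤⟨ length-⊆ Es-unique listed ⟩
          length (throughBig ++ edges₃ (concatMap B blocks ++ O))
            ≡⟨ length-++ throughBig ⟩
          length throughBig + length (edges₃ (concatMap B blocks ++ O))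
            ≤⟨ +-mono-≤ length-throughBig (≤-reflexive (length-edges₃ (concatMap B blocks ++ O))) ⟩
          ∑ blocks through + ∑₃ (concatMap B blocks ++ O) e ∎
          where
          open ≤-Reasoning
          listed-triple : ∀ {x y z} → Edge x y z →
            ⟦ x , y , z ⟧ ∈ throughBig ++ edges₃ (concatMap B blocks ++ O)
          listed-triple {x} {y} {z} E with covered x | covered y | covered z
          ... | inj₁ x∈ | _       | _       = ∈-++⁺ˡ (∈-throughBig x∈ E)
          ... | inj₂ _  | inj₁ y∈ | _       = ∈-++⁺ˡ
            (subst (_∈ throughBig) (⟦⟧-swap₁₂ y x z) (∈-throughBig y∈ (swap₁₂ E)))
          ... | inj₂ _  | inj₂ _  | inj₁ z∈ = ∈-++⁺ˡ (subst (_∈ throughBig)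
            (trans (⟦⟧-swap₁₂ z x y) (⟦⟧-swap₂₃ x z y)) (∈-throughBig z∈ (swap₁₂ (swap₂₃ E))))
          ... | inj₂ x∈ | inj₂ y∈ | inj₂ z∈ =
            ∈-++⁺ʳ throughBig (∈-edges₃ (concatMap B blocks ++ O) x∈ y∈ z∈ E)
          listed : ∀ {p} → p ∈ Es → p ∈ throughBig ++ edges₃ (concatMap B blocks ++ O)
          listed p∈ with _ , _ , _ , refl , E ← Es-edges p∈ = listed-triple E

        length-bound : length Es ≤ 12 * (s * s * s) + s * s + 4 * s
        length-bound = begin
          length Es
            ≤⟨ length≤sums ⟩
          ∑ blocks through + ∑₃ (concatMap B blocks ++ O) e
            ≡⟨ cong (∑ blocks through +_) (trans (∑₃-blocks blocks)
                 (trans (cong (∑ blocks single + ∑₂ blocks pair + ∑₃ blocks triple +_) outside-empty)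
                   (+-identityʳ _))) ⟩
          ∑ blocks through + (∑ blocks single + ∑₂ blocks pair + ∑₃ blocks triple)
            ≡⟨ regroup (∑ blocks through) (∑ blocks single) (∑₂ blocks pair) (∑₃ blocks triple) ⟩
          ∑ blocks through + ∑ blocks single + ∑₂ blocks pair + ∑₃ blocks triple
            ≤⟨ blocks-bound s≡ 3s≡ blocks blocks-distinct length-blocks 0<m ⟩
          12 * (s * s * s) + s * s + 4 * s ∎
          where
          open ≤-Reasoning
          regroup : ∀ a b c d → a + (b + c + d) ≡ a + b + c + d
          regroup = solve-∀
          s≡ : s ≡ 2 + (s ∸ 2)
          s≡ = sym (m+[n∸m]≡n (≤-trans (n≤1+n 2) 3≤s))
          3s≡ : 3 * s ≡ 8 + (3 * s ∸ 8)
          3s≡ = sym (m+[n∸m]≡n (≤-trans (n≤1+n 8) (*-monoʳ-≤ 3 3≤s)))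
          0<m : 0 < s ∸ 2
          0<m = m<n⇒0<n∸m 3≤s

  -- Resilience, covers and the system of a maximum matching.

  module Edges (F : KGraph 3 n) where
    open DecMembership (_≟ˢ_ {n}) using () renaming (_∈?_ to _∈ˢ?_)
    open DecMembership (_≟_ {n}) using (_∈?_)

    nonempty : ∀ {p} → p ∈ edges F → ∃[ x ] x Subset.∈ p
    nonempty {p} p∈ with (x , _) , eq ← 3-set p (All.lookup (uniform F) p∈) =
      x , ∈-elements⁻ p (subst (x ∈_) (sym eq) (here refl))

    -- `ν` ranges over sublists of `edges F`, so the family is replaced by the edges of `F`
    -- belonging to it, in their order in `F`. Its members are nonempty and disjoint, hence
    -- distinct, and none is lost.
    disjoint-length≤ν : ∀ {xs} → AllPairs Disjoint xs → All (_∈ edges F) xs → length xs ≤ ν F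
    disjoint-length≤ν {xs} d xs∈ = ≤-trans
      (length-⊆ (unique-xs d xs∈) (λ p∈ → ∈-filter⁺ (_∈ˢ? xs) (All.lookup xs∈ p∈) p∈))
      (ν-upper F (filter-⊆ (_∈ˢ? xs) (edges F)) (AllPairs-tabulate (Unique.filter⁺ (_∈ˢ? xs) (unique F))
        λ p∈ q∈ → AllPairs-lookup (λ {p} {q} → disjoint-sym {p = p} {q}) d
          (proj₂ (∈-filter⁻ (_∈ˢ? xs) {xs = edges F} p∈)) (proj₂ (∈-filter⁻ (_∈ˢ? xs) {xs = edges F} q∈))))
      where
      unique-xs : ∀ {ys} → AllPairs Disjoint ys → All (_∈ edges F) ys → Unique ys
      unique-xs []       []         = []
      unique-xs (r ∷ rs) (p∈ ∷ ps∈) =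
        All.map (λ { {q} d refl → disjoint-∉ {p = q} {q} d x∈ x∈ }) r ∷ unique-xs rs ps∈
        where x∈ = proj₂ (nonempty p∈)

    vertices : List (Subset n) → List (Fin n)
    vertices = concatMap elements

    length-vertices : ∀ {M} → All (_∈ edges F) M → length (vertices M) ≡ 3 * length M
    length-vertices []                = refl
    length-vertices {p ∷ M} (p∈ ∷ M∈) = trans (length-++ (elements p)) (trans
      (cong₂ _+_ (trans (length-elements p) (All.lookup (uniform F) p∈)) (length-vertices M∈))
      (sym (*-suc 3 (length M))))

    maximum-covers : ∀ {M} → All (_∈ edges F) M → AllPairs Disjoint M → length M ≡ ν F →
      ∀ {p} → p ∈ edges F → ∃[ x ] (x Subset.∈ p × x ∈ vertices M)
    maximum-covers {M} M∈ d len {p} p∈ with any? (_∈? vertices M) (elements p)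
    ... | yes q with x , x∈ , x∈M ← find q = x , ∈-elements⁻ p x∈ , x∈M
    ... | no ¬q = contradiction (disjoint-length≤ν {p ∷ M} (All.tabulate disj ∷ d) (p∈ ∷ M∈))
        (<⇒≱ (s≤s (≤-reflexive (sym len))))
      where
      disj : ∀ {q} → q ∈ M → Disjoint p q
      disj {q} q∈ (x , x∈) with x∈p , x∈q ← Subset.x∈p∩q⁻ p q x∈ =
        ¬q (lose (∈-elements⁺ x∈p) (∈-concatMap⁺ elements (lose q∈ (∈-elements⁺ x∈q))))

    module _ (res : Resilient 2 F) where

      -- By resilience, a maximum matching of `F avoiding T` is maximum in `F` as well, so its
      -- vertices, none of them in `T`, meet every edge of `F`.
      cover : ∀ T → ∣ T ∣ ≤ 2 → ∃[ C ] (length C ≡ 3 * ν F ×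
        (∀ {p} → p ∈ edges F → ∃[ x ] (x Subset.∈ p × x ∈ C × ¬ x Subset.∈ T)))
      cover T ∣T∣≤2 with M , M⊆ , d , len ← ν-attained (F avoiding T) =
        vertices M , trans (length-vertices M∈) (cong (3 *_) lenν) , λ p∈ →
          let x , x∈p , x∈M = maximum-covers M∈ d lenν p∈
              q , q∈ , x∈q = find (∈-concatMap⁻ elements {xs = M} x∈M)
          in x , x∈p , x∈M , disjoint-∉ {p = q} {T} (proj₂ (member q∈)) (∈-elements⁻ q x∈q)
        where
        lenν : length M ≡ ν F
        lenν = trans len (res T ∣T∣≤2)
        member : ∀ {p} → p ∈ M → p ∈ edges F × Disjoint p T
        member p∈ = ∈-filter⁻ (λ p → disjoint? p T) {xs = edges F} (Sublist.lookup M⊆ p∈)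
        M∈ : All (_∈ edges F) M
        M∈ = All.tabulate (proj₁ ∘ member)

      Edge : Fin n → Fin n → Fin n → Set
      Edge x y z = ⟦ x , y , z ⟧ ∈ edges F

      swap₁₂ : ∀ {x y z} → Edge x y z → Edge y x z
      swap₁₂ = subst (_∈ edges F) (⟦⟧-swap₁₂ _ _ _)

      swap₂₃ : ∀ {x y z} → Edge x y z → Edge x z y
      swap₂₃ = subst (_∈ edges F) (⟦⟧-swap₂₃ _ _ _)

      distinct : ∀ {x y z} → Edge x y z → x ≢ y
      distinct {x} {z = z} E refl = contradiction
        (subst (_≤ 2) (All.lookup (uniform F) E) (∣p∣≤length ⟦ x , x , z ⟧ (two ∘ ∈-⟦⟧⁻ x x z)))
        (<⇒≱ ≤-refl)
        where
        two : ∀ {w} → w ∈ x ∷ x ∷ z ∷ [] → w ∈ x ∷ z ∷ []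
        two (here eq)         = here eq
        two (there (here eq)) = here eq
        two (there (there p)) = there p

      matching≤ : ∀ ts → Unique (concatMap verts ts) → All (λ (x , y , z) → Edge x y z) ts →
        length ts ≤ ν F
      matching≤ ts u es = subst (_≤ ν F) (length-map set ts)
        (disjoint-length≤ν (disj ts u) (All.map⁺ es))
        where
        set : Triple (Fin n) → Subset n
        set (x , y , z) = ⟦ x , y , z ⟧
        later : ∀ {w} ts {p} → p ∈ map set ts → w Subset.∈ p → w ∈ concatMap verts ts
        later ((x , y , z) ∷ ts) (here refl) w∈ = ∈-++⁺ˡ (∈-⟦⟧⁻ x y z w∈)
        later (t ∷ ts)           (there p)   w∈ = ∈-++⁺ʳ (verts t) (later ts p w∈)
        disj : ∀ ts → Unique (concatMap verts ts) → AllPairs Disjoint (map set ts)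
        disj []                 u                  = []
        disj ((x , y , z) ∷ ts) u@(x∉ ∷ y∉ ∷ z∉ ∷ u′) = All.tabulate apart ∷ disj ts u′
          where
          apart : ∀ {q} → q ∈ map set ts → Disjoint ⟦ x , y , z ⟧ q
          apart {q} q∈ (w , w∈) with w∈p , w∈q ← Subset.x∈p∩q⁻ ⟦ x , y , z ⟧ q w∈
            with w∈ts ← later ts q∈ w∈q | ∈-⟦⟧⁻ x y z w∈p
          ... | here refl                 = All.lookup x∉ (there (there w∈ts)) refl
          ... | there (here refl)         = All.lookup y∉ (there w∈ts) refl
          ... | there (there (here refl)) = All.lookup z∉ w∈ts refl

      cocover : ∀ x y → ∃[ C ] (length C ≡ 3 * ν F × (∀ {z} → Edge x y z → z ∈ C))
      cocover x y with C , len , cov ← cover (⁅ x ⁆ ∪ ⁅ y ⁆) (∣⁅x⁆∪⁅y⁆∣≤2 x y) =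
        C , len , λ {z} E → third (cov E)
        where
        third : ∀ {z C} →
          ∃[ w ] (w Subset.∈ ⟦ x , y , z ⟧ × w ∈ C × ¬ w Subset.∈ ⁅ x ⁆ ∪ ⁅ y ⁆) → z ∈ C
        third {z} (w , w∈ , w∈C , w∉) with ∈-⟦⟧⁻ x y z w∈
        ... | here refl                 = contradiction (Subset.x∈p∪q⁺ (inj₁ (Subset.x∈⁅x⁆ x))) w∉
        ... | there (here refl)         = contradiction (Subset.x∈p∪q⁺ (inj₂ (Subset.x∈⁅x⁆ y))) w∉
        ... | there (there (here refl)) = w∈C

      link-covered : ∀ x → ∃[ C ] (length C ≡ 3 * ν F × (∀ {y z} → Edge x y z → y ∈ C ⊎ z ∈ C))
      link-covered x with C , len , cov ← cover ⁅ x ⁆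
                            (≤-trans (≤-reflexive (Subset.∣⁅x⁆∣≡1 x)) (n≤1+n 1)) =
        C , len , λ {y} {z} E → other y z (cov E)
        where
        other : ∀ y z {C} →
          ∃[ w ] (w Subset.∈ ⟦ x , y , z ⟧ × w ∈ C × ¬ w Subset.∈ ⁅ x ⁆) → y ∈ C ⊎ z ∈ C
        other y z (w , w∈ , w∈C , w∉) with ∈-⟦⟧⁻ x y z w∈
        ... | here refl                 = contradiction (Subset.x∈⁅x⁆ x) w∉
        ... | there (here refl)         = inj₁ w∈C
        ... | there (there (here refl)) = inj₂ w∈C

      -- The size is a parameter so that a matching of `length M` edges can be transported along
      -- `length M ≡ ν F`.
      record Matching (s : ℕ) : Set where
        field
          v         : Fin s → Fin 3 → Fin n
          v-inj     : ∀ {i j a b} → v i a ≡ v j b → (i , a) ≡ (j , b)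
          v-edge    : ∀ i → Edge (v i 0F) (v i 1F) (v i 2F)
          covers    : ∀ {p} → p ∈ edges F → ∃[ i ] ∃[ c ] v i c Subset.∈ p

      matching : ∀ {M} → M ⊆ edges F → AllPairs Disjoint M → length M ≡ ν F → Matching (length M)
      matching {M} M⊆ d len = record { v = v ; v-inj = v-inj _ _ ; v-edge = v-edge ; covers = covers }
        where
        M∈ : All (_∈ edges F) M
        M∈ = All.tabulate (Sublist.lookup M⊆)
        triple : ∀ i → ∃[ t ] elements (lookup M i) ≡ verts t
        triple i = 3-set (lookup M i) (All.lookup (uniform F) (All.lookup M∈ (∈-lookup i)))
        v : Fin (length M) → Fin 3 → Fin n
        v i = lookup (verts (proj₁ (triple i)))
        v∈ : ∀ i c → v i c Subset.∈ lookup M i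
        v∈ i c = ∈-elements⁻ (lookup M i) (subst (v i c ∈_) (sym (proj₂ (triple i))) (∈-lookup c))
        lookup-disjoint : ∀ {xs : List (Subset n)} → AllPairs Disjoint xs → ∀ {i j} → i ≢ j →
          Disjoint (lookup xs i) (lookup xs j)
        lookup-disjoint {p ∷ xs} (r ∷ rs) {zero}  {zero}  i≢j = contradiction refl i≢j
        lookup-disjoint {p ∷ xs} (r ∷ rs) {zero}  {suc j} i≢j = All.lookup r (∈-lookup j)
        lookup-disjoint {p ∷ xs} (r ∷ rs) {suc i} {zero}  i≢j =
          disjoint-sym {p = p} {lookup xs i} (All.lookup r (∈-lookup i))
        lookup-disjoint {p ∷ xs} (r ∷ rs) {suc i} {suc j} i≢j = lookup-disjoint rs (i≢j ∘ cong suc)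
        v-inj : ∀ i j {a b} → v i a ≡ v j b → (i , a) ≡ (j , b)
        v-inj i j {a} {b} eq with i ≟ j
        ... | yes refl = cong (i ,_) (lookup-injective
          (subst Unique (proj₂ (triple i)) (elements-unique (lookup M i))) eq)
        ... | no i≢j = contradiction (subst (Subset._∈ lookup M j) (sym eq) (v∈ j b))
          (disjoint-∉ {p = lookup M i} {lookup M j} (lookup-disjoint d i≢j) (v∈ i a))
        v-edge : ∀ i → Edge (v i 0F) (v i 1F) (v i 2F)
        v-edge i = subst (_∈ edges F) (⟦⟧-elements (lookup M i) (proj₂ (triple i)))
          (All.lookup M∈ (∈-lookup i))
        covers : ∀ {p} → p ∈ edges F → ∃[ i ] ∃[ c ] v i c Subset.∈ p
        covers p∈ with x , x∈p , x∈M ← maximum-covers M∈ d len p∈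
          with q , q∈ , x∈q ← find (∈-concatMap⁻ elements {xs = M} x∈M)
          with x∈t ← subst (x ∈_) (proj₂ (triple (Any.index q∈)))
                       (subst (λ q → x ∈ elements q) (Any.lookup-index q∈) x∈q) =
          Any.index q∈ , Any.index x∈t , subst (Subset._∈ _) (Any.lookup-index x∈t) x∈p

      maximumMatching : Matching (ν F)
      maximumMatching with M , M⊆ , d , len ← ν-attained F = subst Matching len (matching M⊆ d len)

      module _ (maximum : Matching (ν F)) where
        open Matching maximum

        inside? : ∀ x → Dec (∃[ i ] ∃[ c ] v i c ≡ x)
        inside? x = any-fin? λ i → any-fin? λ c → v i c ≟ x

        O : List (Fin n)
        O = filter (λ x → ¬? (inside? x)) (allFin n)

        system : System n (ν F)
        system = record
          { Edge = Edge ; edge? = λ x y z → ⟦ x , y , z ⟧ ∈ˢ? edges F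
          ; swap₁₂ = swap₁₂ ; swap₂₃ = swap₂₃ ; distinct = distinct
          ; matching≤ = matching≤ ; cocover = cocover
          ; v = v ; v-inj = v-inj ; v-edge = v-edge
          ; O = O ; O-unique = Unique.filter⁺ (λ x → ¬? (inside? x)) (Unique.allFin⁺ n)
          ; O-outside = λ {i} {c} v∈ →
              proj₂ (∈-filter⁻ (λ x → ¬? (inside? x)) {xs = allFin n} v∈) (i , c , refl)
          }

        located : ∀ x → (∃[ i ] ∃[ c ] v i c ≡ x) ⊎ x ∈ O
        located x with inside? x
        ... | yes p = inj₁ p
        ... | no ¬p = inj₂ (∈-filter⁺ (λ x → ¬? (inside? x)) (∈-allFin x) ¬p)

        no-edge-outside : ∀ {x y z} → x ∈ O → y ∈ O → z ∈ O → ¬ Edge x y z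
        no-edge-outside {x} {y} {z} x∈ y∈ z∈ E with i , c , v∈ ← covers E with ∈-⟦⟧⁻ x y z v∈
        ... | here refl                 = System.O-outside system x∈
        ... | there (here refl)         = System.O-outside system y∈
        ... | there (there (here refl)) = System.O-outside system z∈

        open Local system using (e; link-cover-length)

        degree : ∀ x → ∑₂ (allFin n) (e x) ≤ 3 * ν F * (3 * ν F)
        degree x with C , len , cov ← link-covered x =
          subst (λ l → ∑₂ (allFin n) (e x) ≤ l * (3 * ν F)) len
          (link-cover-length x (Unique.allFin⁺ n) (λ _ _ → cov))

        size-bound : 3 ≤ ν F → size F ≤ 12 * (ν F * ν F * ν F) + ν F * ν F + 4 * ν F
        size-bound 3≤ν =
          Bound.length-bound system degree no-edge-outside located 3≤ν (edges F) (unique F) triples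
          where
          triples : ∀ {p} → p ∈ edges F → ∃[ x ] ∃[ y ] ∃[ z ] (p ≡ ⟦ x , y , z ⟧ × Edge x y z)
          triples {p} p∈ = let (x , y , z) , eq = 3-set p (All.lookup (uniform F) p∈)
                               p≡ = ⟦⟧-elements p eq
                           in x , y , z , p≡ , subst (_∈ edges F) p≡ p∈

      size≤ : 3 ≤ ν F → size F ≤ 12 * (ν F * ν F * ν F) + ν F * ν F + 4 * ν F
      size≤ = size-bound maximumMatching

-- The final inequality, in ℕ and in ℚ.

module Arithmetic where
  open import Defs
  open import Data.Nat using (_+_; _*_; _≤_; _<_; _^_; _≤?_)
  open import Data.Nat.Properties
  open import Data.Nat.Tactic.RingSolver using (solve-∀)
  import Data.Integer as ℤ
  import Data.Integer.Properties as ℤ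
  open import Data.Integer using (+_)
  import Data.Rational as ℚ
  import Data.Rational.Properties as ℚ
  import Data.Rational.Unnormalised as ℚᵘ
  import Data.Rational.Unnormalised.Properties as ℚᵘ
  open import Relation.Binary.PropositionalEquality
  open import Relation.Nullary using (yes; no)
  open import Relation.Nullary.Decidable using (toWitness)

  toℚᵘ-fromℕ : ∀ a → ℚ.toℚᵘ (fromℕ a) ℚᵘ.≃ (+ a ℚᵘ./ 1)
  toℚᵘ-fromℕ a = ℚ.toℚᵘ-fromℚᵘ (+ a ℚᵘ./ 1)

  73/6 : ℚ.ℚ
  73/6 = + 73 ℚ./ 6

  -- For unnormalised fractions the inequality unfolds to cross-multiplied integers, where it is the
  -- hypothesis up to factors 1.
  fromℕ-≤-affine : ∀ N a b → 6 * N ≤ 73 * a + 6 * b → fromℕ N ℚ.≤ (73/6 ℚ.* fromℕ a ℚ.+ fromℕ b)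
  fromℕ-≤-affine N a b h = ℚ.toℚᵘ-cancel-≤ (begin
    ℚ.toℚᵘ (fromℕ N)
      ≃⟨ toℚᵘ-fromℕ N ⟩
    + N ℚᵘ./ 1
      ≤⟨ ℚᵘ.*≤* integers ⟩
    (+ 73 ℚᵘ./ 6) ℚᵘ.* (+ a ℚᵘ./ 1) ℚᵘ.+ (+ b ℚᵘ./ 1)
      ≃⟨ ℚᵘ.+-cong (ℚᵘ.*-cong (ℚ.toℚᵘ-fromℚᵘ (+ 73 ℚᵘ./ 6)) (toℚᵘ-fromℕ a)) (toℚᵘ-fromℕ b) ⟨
    ℚ.toℚᵘ 73/6 ℚᵘ.* ℚ.toℚᵘ (fromℕ a) ℚᵘ.+ ℚ.toℚᵘ (fromℕ b)
      ≃⟨ ℚᵘ.+-congˡ (ℚ.toℚᵘ (fromℕ b)) (ℚ.toℚᵘ-homo-* 73/6 (fromℕ a)) ⟨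
    ℚ.toℚᵘ (73/6 ℚ.* fromℕ a) ℚᵘ.+ ℚ.toℚᵘ (fromℕ b)
      ≃⟨ ℚ.toℚᵘ-homo-+ (73/6 ℚ.* fromℕ a) (fromℕ b) ⟨
    ℚ.toℚᵘ (73/6 ℚ.* fromℕ a ℚ.+ fromℕ b) ∎)
    where
    open ℚᵘ.≤-Reasoning
    integers : + N ℤ.* + 6 ℤ.≤ (+ 73 ℤ.* + a ℤ.* + 1 ℤ.+ + b ℤ.* + 6) ℤ.* + 1
    integers = subst₂ ℤ._≤_ (ℤ.pos-* N 6)
      (trans (cong +_ (eq a b)) (trans (ℤ.pos-* (73 * a * 1 + b * 6) 1)
        (cong (ℤ._* + 1) (trans (ℤ.pos-+ (73 * a * 1) (b * 6)) (cong₂ ℤ._+_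
          (trans (ℤ.pos-* (73 * a) 1) (cong (ℤ._* + 1) (ℤ.pos-* 73 a))) (ℤ.pos-* b 6))))))
      (ℤ.+≤+ (≤-trans (≤-reflexive (*-comm N 6)) h))
      where
      eq : ∀ a b → 73 * a + 6 * b ≡ (73 * a * 1 + b * 6) * 1
      eq = solve-∀

  -- As 73 = 6 · 12 + 1, one s³ is left to absorb the lower order terms.
  6N≤73s³ : ∀ N s c → N ≤ 12 * (s * s * s) + s * s + 4 * s →
    6 * (s * s) + 24 * s ≤ s * s * s + c → 6 * N ≤ 73 * s ^ 3 + c
  6N≤73s³ N s c bound h = begin
    6 * N                                           ≤⟨ *-monoʳ-≤ 6 bound ⟩
    6 * (12 * (s * s * s) + s * s + 4 * s)          ≡⟨ expand s ⟩
    72 * (s * s * s) + (6 * (s * s) + 24 * s)       ≤⟨ +-monoʳ-≤ (72 * (s * s * s)) h ⟩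
    72 * (s * s * s) + (s * s * s + c)              ≡⟨ collect s c ⟩
    73 * s ^ 3 + c                                  ∎
    where
    open ≤-Reasoning
    expand : ∀ s → 6 * (12 * (s * s * s) + s * s + 4 * s) ≡ 72 * (s * s * s) + (6 * (s * s) + 24 * s)
    expand = solve-∀
    collect : ∀ s c → 72 * (s * s * s) + (s * s * s + c) ≡ 73 * (s * (s * (s * 1))) + c
    collect = solve-∀

  -- 24s ≤ 27s ≤ 3s², and 9s² ≤ s³.
  quadratic≤cubic : ∀ s → 9 ≤ s → 6 * (s * s) + 24 * s ≤ s * s * s
  quadratic≤cubic s 9≤s = begin
    6 * (s * s) + 24 * s
      ≤⟨ +-monoʳ-≤ (6 * (s * s)) (*-monoˡ-≤ s (≤-trans (m≤m+n 24 3) (*-monoʳ-≤ 3 9≤s))) ⟩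
    6 * (s * s) + 3 * s * s     ≡⟨ collect s ⟩
    9 * (s * s)                 ≤⟨ *-monoˡ-≤ (s * s) 9≤s ⟩
    s * (s * s)                 ≡⟨ *-assoc s s s ⟨
    s * s * s                   ∎
    where
    open ≤-Reasoning
    collect : ∀ s → 6 * (s * s) + 3 * s * s ≡ 9 * (s * s)
    collect = solve-∀

  -- The constant is 6 · 50; the values below 9 are checked one by one.
  quadratic≤cubic+300 : ∀ s → 6 * (s * s) + 24 * s ≤ s * s * s + 300
  quadratic≤cubic+300 s with 9 ≤? s
  ... | yes 9≤s = ≤-trans (quadratic≤cubic s 9≤s) (m≤m+n _ 300)
  ... | no  9≰s = small s (≰⇒> 9≰s)
    where
    small : ∀ s → s < 9 → 6 * (s * s) + 24 * s ≤ s * s * s + 300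
    small s s<9 = toWitness {a? = allUpTo? (λ s → 6 * (s * s) + 24 * s ≤? s * s * s + 300) 9} _ s<9

  fromℕ-≤-linear : ∀ N a → 6 * N ≤ 73 * a + 0 → fromℕ N ℚ.≤ (73/6 ℚ.* fromℕ a)
  fromℕ-≤-linear N a h =
    subst (fromℕ N ℚ.≤_) (ℚ.+-identityʳ (73/6 ℚ.* fromℕ a)) (fromℕ-≤-affine N a 0 h)

open import Defs
open import Data.Nat using (ℕ; _≤_; _^_)
open import Data.Integer using (+_)
open import Data.Rational using (_/_; _+_; _*_)
open import Data.Product using (_×_; _,_)
open import Data.Nat.Properties using (≤-trans; m≤m+n)
open import Relation.Binary.PropositionalEquality using (refl)
open Arithmetic
open KGraphs using (module Edges)

theorem1p9 : (∀ (s : ℕ) → 3 ≤ s → m[ 3 , s ]≤ (((+ 73) / 6) * fromℕ (s ^ 3) + fromℕ 50))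
    × (∀ (s : ℕ) → 21 ≤ s → m[ 3 , s ]≤ (((+ 73) / 6) * fromℕ (s ^ 3)))
theorem1p9 =
  (λ { _ 3≤s _ (_ , F , resilient , refl , refl) → fromℕ-≤-affine (size F) (ν F ^ 3) 50
    (6N≤73s³ (size F) (ν F) 300 (Edges.size≤ F resilient 3≤s) (quadratic≤cubic+300 (ν F))) }) ,
  (λ { _ 21≤s _ (_ , F , resilient , refl , refl) → fromℕ-≤-linear (size F) (ν F ^ 3)
    (6N≤73s³ (size F) (ν F) 0 (Edges.size≤ F resilient (≤-trans (m≤m+n 3 18) 21≤s))
      (≤-trans (quadratic≤cubic (ν F) (≤-trans (m≤m+n 9 12) 21≤s)) (m≤m+n _ 0))) })
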